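{- Assume $S$ is symmetric. Then for every integer $k\ge0$, $F_k=F_k^+F_k^-$. Moreover, let $k\ge1$ with $F_{k+1}\neq0$ (so that $1-A_k$ is invertible and $F^\pm_{k+1}\ne0$) and put $E_{k,\ell}:=[(1-A_k)^{ -1}]_{0,\ell}$ for $0\le\ell\le k$. Then for every $\ell$ with $0\le\ell<k/2$, $$E_{k,\ell}+E_{k,k-\ell}=\frac{F^+_{k,\ell}}{F^+_{k+1}},\qquad E_{k,\ell}-E_{k,k-\ell}=\frac{F^-_{k,\ell}}{F^-_{k+1}},$$ and if $k$ is even, $E_{k,k/2}=F^+_{k,k/2}/F^+_{k+1}$.
   Context: Let $S$ be a finite set of integers with $a:=\max S\ge1$; $S$ is called symmetric if $-S=S$ and $\omega_{ -s}=\omega_s$ for all $s\in S$, where each $s\in S$ carries a weight $\omega_s$ in a field $K$ of characteristic $0$; set $\omega_s:=0$ for $s\notin S$. For $k\ge0$, $A_k$ is the $(k+1)\times(k+1)$ matrix with rows and columns indexed by $0,\dots,k$ whose $(i,j)$ entry is $\omega_{j-i}$; $F_0:=1$ and $F_k:=\det(1-A_{k-1})$ for $k\ge1$. (For formal weights, $E_{k,\ell}$ is the weighted generating function of paths with steps in $S$ from $0$ to $\ell$ staying within $[0,k]$.) For $k\ge0$, $A_k^+$ is the matrix with rows and columns indexed by the integers $0\le i,j\le k/2$ and entries $\omega_{j-i}+\omega_{k-j-i}$ if $j<k/2$ and $\omega_{j-i}$ if $j=k/2$; $A_k^-$ is the matrix with rows and columns indexed by the integers $0\le i,j<k/2$ and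 entries $\omega_{j-i}-\omega_{k-j-i}$. The determinant of an empty matrix is $1$. Put $F^\pm_0:=1$ and $F^\pm_k:=\det(1-A^\pm_{k-1})$ for $k\ge1$. For an index $\ell$ of $A^\pm_k$, $F^\pm_{k,\ell}$ is the $(\ell,0)$ cofactor of $1-A_k^\pm$, i.e. $(-1)^\ell$ times the determinant of $1-A_k^\pm$ with row $\ell$ and column $0$ deleted. -}

module Defs where

open import Level using (_⊔_) renaming (suc to lsuc)
open import Algebra.Bundles using (CommutativeRing)
import Algebra.Properties.Semiring.Exp as Exp
import Algebra.Properties.Semiring.Mult as Mult
import Algebra.Properties.CommutativeMonoid.Sum as Sum
open import Data.Bool.Base using (if_then_else_)
open import Data.Fin.Base using (Fin; zero; suc; toℕ; fromℕ<; punchIn)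
import Data.Fin.Properties as Fin
open import Data.Integer.Base as ℤ using (ℤ; +_)
open import Data.List.Base using (List; map)
open import Data.List.Membership.Propositional using (_∈_; _∉_)
open import Data.List.Relation.Binary.BagAndSetEquality using (_∼[_]_; set)
open import Data.Nat.Base as ℕ using (ℕ; zero; suc; ⌊_/2⌋; ⌈_/2⌉; _≤_; _<_; s≤s)
import Data.Nat.Properties as ℕ
open import Data.Product.Base using (_×_)
open import Relation.Nullary using (¬_; does)
open import Relation.Binary.PropositionalEquality using (_≡_; sym; cong; subst)

record Field c e : Set (lsuc (c ⊔ e)) where
  infix 9 _⁻¹[_]
  field
    commutativeRing : CommutativeRing c e
  open CommutativeRing commutativeRing public hiding (zero)
  field
    1≉0     : 1# ≉ 0#
    _⁻¹[_]  : ∀ x → x ≉ 0# → Carrier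
    inverse : ∀ x (x≉0 : x ≉ 0#) → x * x ⁻¹[ x≉0 ] ≈ 1#

module _ {c e} (K : Field c e) where
  open Field K

  CharacteristicZero : Set e
  CharacteristicZero = ∀ n → suc n · 1# ≉ 0#
    where open Mult semiring renaming (_×_ to _·_)

  -- The list S is read as a finite set: order and repetitions are irrelevant.
  record WeightedSet : Set (c ⊔ e) where
    field
      S     : List ℤ
      a     : ℤ
      a∈S   : a ∈ S
      a-max : ∀ {s} → s ∈ S → s ℤ.≤ a
      a≥1   : ℤ.1ℤ ℤ.≤ a
      ω     : ℤ → Carrier
      ω-∉   : ∀ {s} → s ∉ S → ω s ≈ 0#

  Symmetric : WeightedSet → Set e
  Symmetric W = (map ℤ.-_ S ∼[ set ] S) × (∀ {s} → s ∈ S → ω (ℤ.- s) ≈ ω s)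
    where open WeightedSet W

module Matrices {c e} (K : Field c e) where
  open Field K
  open Sum +-commutativeMonoid using (sum)
  open Exp semiring using (_^_)

  Matrix : ℕ → Set c
  Matrix n = Fin n → Fin n → Carrier

  _≈ᴹ_ : ∀ {n} → Matrix n → Matrix n → Set e
  M ≈ᴹ N = ∀ i j → M i j ≈ N i j

  1ᴹ : ∀ {n} → Matrix n
  1ᴹ i j = if does (i Fin.≟ j) then 1# else 0#

  1-_ : ∀ {n} → Matrix n → Matrix n
  (1- M) i j = 1ᴹ i j - M i j

  _*ᴹ_ : ∀ {n} → Matrix n → Matrix n → Matrix n
  (M *ᴹ N) i j = sum λ l → M i l * N l j

  IsInverseOf : ∀ {n} → Matrix n → Matrix n → Set e
  IsInverseOf M N = (M *ᴹ N) ≈ᴹ 1ᴹ × (N *ᴹ M) ≈ᴹ 1ᴹ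

  minor : ∀ {n} → Matrix (suc n) → Fin (suc n) → Fin (suc n) → Matrix n
  minor M i j i′ j′ = M (punchIn i i′) (punchIn j j′)

  -- Laplace expansion along column 0.
  det      : ∀ {n} → Matrix n → Carrier
  cofactor : ∀ {n} → Matrix (suc n) → Fin (suc n) → Fin (suc n) → Carrier

  det {zero}  M = 1#
  det {suc n} M = sum λ i → M i zero * cofactor M i zero

  cofactor M i j = (- 1#) ^ (toℕ i ℕ.+ toℕ j) * det (minor M i j)

2ℓ≤k⇒ℓ≤⌊k/2⌋ : ∀ {k} ℓ → 2 ℕ.* ℓ ≤ k → ℓ ≤ ⌊ k /2⌋
2ℓ≤k⇒ℓ≤⌊k/2⌋ {k} ℓ p = subst (_≤ ⌊ k /2⌋) (sym (ℕ.n≡⌊n+n/2⌋ ℓ))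
  (ℕ.⌊n/2⌋-mono (subst (_≤ k) (cong (ℓ ℕ.+_) (ℕ.+-identityʳ ℓ)) p))

2ℓ<k⇒ℓ<⌈k/2⌉ : ∀ {k} ℓ → 2 ℕ.* ℓ < k → ℓ < ⌈ k /2⌉
2ℓ<k⇒ℓ<⌈k/2⌉ {k} ℓ p =
  2ℓ≤k⇒ℓ≤⌊k/2⌋ (suc ℓ) (subst (_≤ suc k) (sym (ℕ.*-suc 2 ℓ)) (s≤s p))

-- The natural number ℓ as an index of A k, A⁺ k and A⁻ k respectively.
index : ∀ {k} ℓ → ℓ ≤ k → Fin (suc k)
index ℓ ℓ≤k = fromℕ< (s≤s ℓ≤k)

index⁺ : ∀ {k} ℓ → 2 ℕ.* ℓ ≤ k → Fin (suc ⌊ k /2⌋)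
index⁺ ℓ 2ℓ≤k = fromℕ< (s≤s (2ℓ≤k⇒ℓ≤⌊k/2⌋ ℓ 2ℓ≤k))

index⁻ : ∀ {k} ℓ → 2 ℕ.* ℓ < k → Fin ⌈ k /2⌉
index⁻ ℓ 2ℓ<k = fromℕ< (2ℓ<k⇒ℓ<⌈k/2⌉ ℓ 2ℓ<k)

2ℓ<k⇒ℓ≤k : ∀ {k} ℓ → 2 ℕ.* ℓ < k → ℓ ≤ k
2ℓ<k⇒ℓ≤k ℓ p = ℕ.≤-trans (ℕ.m≤m+n ℓ (ℓ ℕ.+ 0)) (ℕ.<⇒≤ p)

2ℓ≡k⇒ℓ≤k : ∀ {k} ℓ → 2 ℕ.* ℓ ≡ k → ℓ ≤ k
2ℓ≡k⇒ℓ≤k {k} ℓ p = subst (ℓ ≤_) p (ℕ.m≤m+n ℓ (ℓ ℕ.+ 0))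

module Transfer {c e} (K : Field c e) (W : WeightedSet K) where
  open Field K
  open WeightedSet W
  open Matrices K

  A : ∀ k → Matrix (suc k)
  A k i j = ω (+ toℕ j ℤ.- + toℕ i)

  F : ℕ → Carrier
  F zero    = 1#
  F (suc k) = det (1- A k)

  -- The integers 0 ≤ i ≤ k/2 are exactly those with 0 ≤ i < 1 + ⌊k/2⌋.
  A⁺ : ∀ k → Matrix (suc ⌊ k /2⌋)
  A⁺ k i j =
    if does (2 ℕ.* toℕ j ℕ.<? k)
    then ω (+ toℕ j ℤ.- + toℕ i) + ω (+ k ℤ.- + toℕ j ℤ.- + toℕ i)
    else ω (+ toℕ j ℤ.- + toℕ i)

  -- The integers 0 ≤ i < k/2 are exactly those with 0 ≤ i < ⌈k/2⌉.
  A⁻ : ∀ k → Matrix ⌈ k /2⌉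
  A⁻ k i j = ω (+ toℕ j ℤ.- + toℕ i) - ω (+ k ℤ.- + toℕ j ℤ.- + toℕ i)

  F⁺ : ℕ → Carrier
  F⁺ zero    = 1#
  F⁺ (suc k) = det (1- A⁺ k)

  F⁻ : ℕ → Carrier
  F⁻ zero    = 1#
  F⁻ (suc k) = det (1- A⁻ k)

  F⁺-cofactor : ∀ k → Fin (suc ⌊ k /2⌋) → Carrier
  F⁺-cofactor k ℓ = cofactor (1- A⁺ k) ℓ zero

  -- A⁻ 0 is empty and has no indices.
  F⁻-cofactor : ∀ k → Fin ⌈ k /2⌉ → Carrier
  F⁻-cofactor zero    ()
  F⁻-cofactor (suc k) ℓ = cofactor (1- A⁻ (suc k)) ℓ zero

{-# OPTIONS --safe #-}

-- The reflection i ↦ k - i commutes with 1 - A_k, so folding a row vector x into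
-- its symmetric part (x_j + x_{k-j}) and antisymmetric part (x_j - x_{k-j})
-- intertwines 1 - A_k with 1 - A⁺_k and 1 - A⁻_k.  As 2 is invertible the folding
-- is an isomorphism, hence the determinants multiply.  Folding row 0 of the
-- inverse E yields a row u with u (1 - A±_k) = e_0, so Cramer's rule gives u_ℓ.
--
-- The determinant theory rests on one fact: an alternating multilinear form D on
-- the rows of square matrices satisfies D M = det M * D 1.

module Submission where

open import Defs
open import Algebra.Bundles using (CommutativeRing)
open import Data.Bool.Base using (if_then_else_)
open import Data.Fin.Base as Fin
  using (Fin; zero; suc; toℕ; punchIn; punchOut; splitAt; _↑ˡ_; _↑ʳ_; opposite; inject≤)
import Data.Fin.Properties as Fin
open import Data.Integer.Base as ℤ using (+_)
import Data.Integer.Properties as ℤ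
import Data.Integer.Solver
open Data.Integer.Solver.+-*-Solver using (_:-_; :-_) renaming (solve to ℤ-solve; _:=_ to _ℤ:=_)
open import Data.List.Membership.DecPropositional ℤ._≟_ using (_∈?_)
open import Data.Nat.Base as ℕ using (ℕ; zero; suc; ⌊_/2⌋; ⌈_/2⌉; _∸_; _≤_; _<_)
  renaming (_*_ to _*ℕ_)
open import Data.Nat.Properties using (m∸n≤m; ≤-reflexive; <⇒≤)
import Data.Nat.Properties as ℕ
open import Data.Product.Base using (Σ-syntax; _×_; _,_)
open import Data.Sum.Base using (inj₁; inj₂; [_,_])
open import Data.Vec.Base as Vec using (Vec; []; _∷_; lookup; map; tabulate; _[_]≔_)
import Data.Vec.Functional as F
import Data.Vec.Properties as Vec
open import Function.Base using (_∘_)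
import Level
open import Relation.Binary.Definitions using (tri<; tri≈; tri>)
open import Relation.Binary.PropositionalEquality as ≡ using (_≡_; _≢_)
open import Relation.Nullary using (¬_; Dec; does; yes; no; contradiction)
open import Relation.Nullary.Decidable using (dec-true; dec-false)

-- Row vectors with matrices acting on the right fit `A⁺` and `A⁻`: there the reflected weight is
-- added or subtracted column by column, so folding a row of `1- A k` gives a row of the small
-- matrix. The middle column stays single because it is its own mirror image. The sizes `⌊k/2⌋ + 1`
-- and `⌈k/2⌉` add up to `k + 1`, so both folds together form a square linear map. Its determinant
-- is never evaluated: it occurs on both sides of the intertwining relation and is cancelled by the
-- determinant of an explicit unfolding map, which is where 1/2 enters. The determinant is given
-- only as a recursive expansion along column 0. Uniqueness of alternating forms replaces sums over
-- permutations: multiplicativity and the block-diagonal formula both come from evaluating a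
-- suitable form at the identity. The `(ℓ,0)` cofactors arise because the row solved for has
-- right-hand side `e_0`, and replacing row `ℓ` by `e_0` turns the determinant into exactly that
-- cofactor.

module Determinants {c e} (R : CommutativeRing c e) where
  open CommutativeRing R hiding (zero)
  open import Algebra.Properties.Ring ring using (-1*x≈-x; -‿distribˡ-*)
  open import Algebra.Properties.Group +-group using (x∙y⁻¹≈ε⇒x≈y)
  open import Algebra.Properties.Semiring.Sum semiring
    using (sum; sum-cong-≋; *-distribˡ-sum; ∑-distrib-+)
  open import Algebra.Properties.Semiring.Exp semiring using (_^_)
  open import Algebra.Solver.Ring.NaturalCoefficients.Default commutativeSemiring
    using (solve; _:+_; _:*_; _:=_)
  open import Relation.Binary.Reasoning.Setoid setoid

  -- Rows, matrices as vectors of rows, and unit vectors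

  Row : ℕ → Set c
  Row w = Fin w → Carrier

  -- A `Vec` of rows makes row replacement and its laws available up to `_≡_`; only the entries of a
  -- row are compared pointwise in the setoid.
  Rows : ℕ → ℕ → Set c
  Rows n w = Vec (Row w) n

  infix 4 _≋_ _≋ᴹ_

  _≋_ : ∀ {w} → Row w → Row w → Set e
  x ≋ y = ∀ j → x j ≈ y j

  _≋ᴹ_ : ∀ {n w} → Rows n w → Rows n w → Set e
  M ≋ᴹ N = ∀ i → lookup M i ≋ lookup N i

  basis : ∀ {w} → Fin w → Row w
  basis i j = if does (i Fin.≟ j) then 1# else 0#

  infixl 6 _·_⊕_

  _·_⊕_ : ∀ {w} → Carrier → Row w → Row w → Row w
  (a · x ⊕ y) j = a * x j + y j

  0ʳ : ∀ {w} → Row w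
  0ʳ _ = 0#

  tl : ∀ {w} → Row (suc w) → Row w
  tl x j = x (suc j)

  -- Signs are written as a factor -1#, which the semiring solver treats as an atom.
  -1# : Carrier
  -1# = - 1#

  x+-1*x≈0 : ∀ x → x + -1# * x ≈ 0#
  x+-1*x≈0 x = trans (+-congˡ (-1*x≈-x x)) (-‿inverseʳ x)

  ≋ᴹ-refl : ∀ {n w} {M : Rows n w} → M ≋ᴹ M
  ≋ᴹ-refl _ _ = refl

  ∷-cong : ∀ {n w} {x y : Row w} {M N : Rows n w} →
           x ≋ y → M ≋ᴹ N → (x ∷ M) ≋ᴹ (y ∷ N)
  ∷-cong x≋y M≋N zero    = x≋y
  ∷-cong x≋y M≋N (suc i) = M≋N i

  ≔-cong : ∀ {n w} (M : Rows n w) i {x y : Row w} →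
           x ≋ y → (M [ i ]≔ x) ≋ᴹ (M [ i ]≔ y)
  ≔-cong (_ ∷ M) zero    x≋y = ∷-cong x≋y (≋ᴹ-refl {M = M})
  ≔-cong (_ ∷ M) (suc i) x≋y = ∷-cong (λ _ → refl) (≔-cong M i x≋y)

  map-tl-cong : ∀ {n w} {M N : Rows n (suc w)} → M ≋ᴹ N → map tl M ≋ᴹ map tl N
  map-tl-cong {M = M} {N} M≋N i j
    rewrite Vec.lookup-map i tl M | Vec.lookup-map i tl N = M≋N i (suc j)

  basis-refl : ∀ {w} (i : Fin w) → basis i i ≈ 1#
  basis-refl i with i Fin.≟ i
  ... | yes _  = refl
  ... | no i≢i = contradiction ≡.refl i≢i

  basis-≢ : ∀ {w} {i j : Fin w} → i ≢ j → basis i j ≈ 0#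
  basis-≢ {i = i} {j} i≢j with i Fin.≟ j
  ... | yes i≡j = contradiction i≡j i≢j
  ... | no _    = refl

  basis-sym : ∀ {n} (i j : Fin n) → basis i j ≈ basis j i
  basis-sym i j with j Fin.≟ i
  ... | yes ≡.refl = basis-refl j
  ... | no j≢i     = basis-≢ (j≢i ∘ ≡.sym)

  basis-injective : ∀ {n n′} {f : Fin n → Fin n′} → (∀ {i j} → f i ≡ f j → i ≡ j) →
                    ∀ i j → basis (f i) (f j) ≈ basis i j
  basis-injective {f = f} f-inj i j with i Fin.≟ j
  ... | yes ≡.refl = basis-refl (f i)
  ... | no i≢j     = basis-≢ (i≢j ∘ f-inj)

  sum-zero : ∀ {n} {t : Row n} → t ≋ 0ʳ → sum t ≈ 0#
  sum-zero {zero}  t≋0 = refl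
  sum-zero {suc n} t≋0 = trans (+-cong (t≋0 zero) (sum-zero (t≋0 ∘ suc))) (+-identityˡ 0#)

  -- Linear functionals

  -- One law covers additivity and homogeneity, so each linearity proof is a single computation.
  -- Congruence is a separate field because a function on rows need not respect the setoid equality
  -- of entries.
  record Linear {w} (φ : Row w → Carrier) : Set (c Level.⊔ e) where
    field
      cong   : ∀ {x y} → x ≋ y → φ x ≈ φ y
      linear : ∀ a x y → φ (a · x ⊕ y) ≈ a * φ x + φ y

    zero-homo : ∀ {x} → x ≋ 0ʳ → φ x ≈ 0#
    zero-homo {x} x≋0 = begin
      φ x              ≈⟨ cong (λ j → trans (x≋0 j) (sym (trans (+-comm _ _) (x+-1*x≈0 0#)))) ⟩
      φ (-1# · 0ʳ ⊕ 0ʳ)  ≈⟨ linear -1# 0ʳ 0ʳ ⟩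
      -1# * φ 0ʳ + φ 0ʳ  ≈⟨ +-comm _ _ ⟩
      φ 0ʳ + -1# * φ 0ʳ  ≈⟨ x+-1*x≈0 _ ⟩
      0#               ∎

  open Linear

  LinearMap : ∀ {v w} → (Row v → Row w) → Set (c Level.⊔ e)
  LinearMap φ = ∀ j → Linear (λ x → φ x j)

  LinearMap-∘ : ∀ {u v} {φ : Row v → Carrier} {ψ : Row u → Row v} →
                Linear φ → LinearMap ψ → Linear (φ ∘ ψ)
  LinearMap-∘ φ ψ .cong x≋y      = φ .cong λ j → ψ j .cong x≋y
  LinearMap-∘ φ ψ .linear a x y = trans (φ .cong λ j → ψ j .linear a x y) (φ .linear a _ _)

  private
    cons0 : ∀ {w} → Row w → Row (suc w)
    cons0 y zero    = 0#
    cons0 y (suc j) = y j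

  -- Induction on the width splits off coordinate 0. Taking for `φ` one row slot of the determinant
  -- gives the expansion behind Cramer's rule.
  linear-expand : ∀ {w} {φ : Row w → Carrier} → Linear φ →
                  ∀ x → φ x ≈ sum (λ j → x j * φ (basis j))
  linear-expand {zero}  φ-lin x = zero-homo φ-lin λ ()
  linear-expand {suc w} {φ} φ-lin x = begin
    φ x ≈⟨ φ-lin .cong x≋ ⟩
    φ (x zero · basis zero ⊕ cons0 (tl x))
      ≈⟨ φ-lin .linear _ _ _ ⟩
    x zero * φ (basis zero) + φ (cons0 (tl x))
      ≈⟨ +-congˡ (linear-expand tail-lin (tl x)) ⟩
    x zero * φ (basis zero) + sum (λ j → x (suc j) * φ (cons0 (basis j)))
      ≈⟨ +-congˡ (sum-cong-≋ λ j → *-congˡ {x (suc j)} (φ-lin .cong (shift j))) ⟩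
    x zero * φ (basis zero) + sum (λ j → x (suc j) * φ (basis (suc j))) ∎
    where
    x≋ : x ≋ (x zero · basis zero ⊕ cons0 (tl x))
    x≋ zero    = sym (trans (+-identityʳ _) (*-identityʳ _))
    x≋ (suc j) = sym (trans (+-congʳ (zeroʳ _)) (+-identityˡ _))

    shift : ∀ j → cons0 (basis j) ≋ basis (suc j)
    shift j zero    = refl
    shift j (suc k) with j Fin.≟ k
    ... | yes _ = refl
    ... | no  _ = refl

    tail-lin : Linear (φ ∘ cons0)
    tail-lin .cong x≋y = φ-lin .cong λ where
      zero    → refl
      (suc j) → x≋y j
    tail-lin .linear a x y = trans
      (φ-lin .cong λ where
        zero    → sym (trans (+-congʳ (zeroʳ a)) (+-identityˡ 0#))
        (suc j) → refl)
      (φ-lin .linear a (cons0 x) (cons0 y))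

  linear-ext : ∀ {w} {φ ψ : Row w → Carrier} → Linear φ → Linear ψ →
               (∀ j → φ (basis j) ≈ ψ (basis j)) → ∀ x → φ x ≈ ψ x
  linear-ext φ-lin ψ-lin φ≈ψ x = begin
    _ ≈⟨ linear-expand φ-lin x ⟩
    _ ≈⟨ sum-cong-≋ (λ j → *-congˡ (φ≈ψ j)) ⟩
    _ ≈⟨ linear-expand ψ-lin x ⟨
    _ ∎

  proj-linear : ∀ {w} (j : Fin w) → Linear (λ x → x j)
  proj-linear j .cong x≋y      = x≋y j
  proj-linear j .linear a x y = refl

  infixl 7 _⟨*⟩_

  -- Row `i` of `M *ᴹ N` is definitionally `M i ⟨*⟩ N`, so matrix identities can be used as
  -- identities between rows.
  _⟨*⟩_ : ∀ {n w} → Row n → (Fin n → Row w) → Row w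
  (x ⟨*⟩ M) j = sum λ i → x i * M i j

  ⟨*⟩-linear : ∀ {n w} (M : Fin n → Row w) → LinearMap (_⟨*⟩ M)
  ⟨*⟩-linear M j .cong x≋y      = sum-cong-≋ λ i → *-congʳ (x≋y i)
  ⟨*⟩-linear M j .linear a x y = begin
    sum (λ i → (a * x i + y i) * M i j)
      ≈⟨ sum-cong-≋ (λ i → solve 4 (λ a x y m → (a :* x :+ y) :* m := a :* (x :* m) :+ y :* m)
                             refl a (x i) (y i) (M i j)) ⟩
    sum (λ i → a * (x i * M i j) + y i * M i j)
      ≈⟨ ∑-distrib-+ (λ i → a * (x i * M i j)) (λ i → y i * M i j) ⟩
    sum (λ i → a * (x i * M i j)) + sum (λ i → y i * M i j)
      ≈⟨ +-congʳ (*-distribˡ-sum a (λ i → x i * M i j)) ⟨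
    a * sum (λ i → x i * M i j) + sum (λ i → y i * M i j) ∎

  basis-⟨*⟩ : ∀ {n w} (i : Fin n) (M : Fin n → Row w) → (basis i ⟨*⟩ M) ≋ M i
  basis-⟨*⟩ {suc n} zero M j = begin
    1# * M zero j + sum (λ l → 0# * M (suc l) j) ≈⟨ +-cong (*-identityˡ _) (sum-zero λ l → zeroˡ (M (suc l) j)) ⟩
    M zero j + 0#                                ≈⟨ +-identityʳ _ ⟩
    M zero j                                     ∎
  basis-⟨*⟩ {suc n} (suc i) M j = begin
    0# * M zero j + sum (λ l → basis (suc i) (suc l) * M (suc l) j)
      ≈⟨ +-cong (zeroˡ _) (sum-cong-≋ λ l → *-congʳ {M (suc l) j} (unshift l)) ⟩
    0# + (basis i ⟨*⟩ (M ∘ suc)) j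
      ≈⟨ +-identityˡ _ ⟩
    (basis i ⟨*⟩ (M ∘ suc)) j
      ≈⟨ basis-⟨*⟩ i (M ∘ suc) j ⟩
    M (suc i) j ∎
    where
    unshift : ∀ l → basis (suc i) (suc l) ≈ basis i l
    unshift l with i Fin.≟ l
    ... | yes _ = refl
    ... | no  _ = refl

  -- Both sides are linear in `x`, so unit vectors suffice and no double sum has to be exchanged.
  ⟨*⟩-assoc : ∀ {n m w} x (M : Fin n → Row m) (N : Fin m → Row w) →
              ((x ⟨*⟩ M) ⟨*⟩ N) ≋ (x ⟨*⟩ (λ i → M i ⟨*⟩ N))
  ⟨*⟩-assoc x M N j = linear-ext
    (LinearMap-∘ (⟨*⟩-linear N j) (⟨*⟩-linear M))
    (⟨*⟩-linear (λ i → M i ⟨*⟩ N) j)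
    (λ i → trans (⟨*⟩-linear N j .cong (basis-⟨*⟩ i M)) (sym (basis-⟨*⟩ i (λ i → M i ⟨*⟩ N) j)))
    x

  -- Multilinear and alternating forms

  -- Height and width are independent, since fixing some rows of a square form leaves a form in
  -- fewer rows of the same width.
  record Multilinear {n w} (D : Rows n w → Carrier) : Set (c Level.⊔ e) where
    field
      rows-cong : ∀ {M N} → M ≋ᴹ N → D M ≈ D N
      row-linear : ∀ M i a x y →
        D (M [ i ]≔ (a · x ⊕ y)) ≈ a * D (M [ i ]≔ x) + D (M [ i ]≔ y)

    at : ∀ M i → Linear (λ x → D (M [ i ]≔ x))
    at M i .cong x≋y = rows-cong (≔-cong M i x≋y)
    at M i .linear   = row-linear M i

    zero-row : ∀ M i → lookup M i ≋ 0ʳ → D M ≈ 0#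
    zero-row M i Mᵢ≋0 = trans
      (reflexive (≡.cong D (≡.sym (Vec.[]≔-lookup M i))))
      (zero-homo (at M i) Mᵢ≋0)

  open Multilinear

  ∷-multilinear : ∀ {n w} {D : Rows (suc n) w → Carrier} → Multilinear D →
                  ∀ x → Multilinear (D ∘ (x ∷_))
  ∷-multilinear D x .rows-cong M≋N         = D .rows-cong (∷-cong (λ _ → refl) M≋N)
  ∷-multilinear D x .row-linear M i a y z = D .row-linear (x ∷ M) (suc i) a y z

  map-multilinear : ∀ {n v w} {D : Rows n w → Carrier} {φ : Row v → Row w} →
                    Multilinear D → LinearMap φ → Multilinear (D ∘ map φ)
  map-multilinear {φ = φ} D-lin φ-lin .rows-cong {M} {N} M≋N = D-lin .rows-cong λ i j → begin
    lookup (map φ M) i j ≡⟨ ≡.cong (λ r → r j) (Vec.lookup-map i φ M) ⟩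
    φ (lookup M i) j     ≈⟨ φ-lin j .cong (M≋N i) ⟩
    φ (lookup N i) j     ≡⟨ ≡.cong (λ r → r j) (Vec.lookup-map i φ N) ⟨
    lookup (map φ N) i j ∎
  map-multilinear {D = D} {φ} D-lin φ-lin .row-linear M i a x y = begin
    D (map φ (M [ i ]≔ (a · x ⊕ y)))
      ≡⟨ ≡.cong D (Vec.map-[]≔ φ M i) ⟩
    D (map φ M [ i ]≔ φ (a · x ⊕ y))
      ≈⟨ D-lin .rows-cong (≔-cong (map φ M) i λ j → φ-lin j .linear a x y) ⟩
    D (map φ M [ i ]≔ (a · φ x ⊕ φ y))
      ≈⟨ D-lin .row-linear (map φ M) i a (φ x) (φ y) ⟩
    a * D (map φ M [ i ]≔ φ x) + D (map φ M [ i ]≔ φ y)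
      ≡⟨ ≡.cong₂ (λ u v → a * D u + D v) (Vec.map-[]≔ φ M i) (Vec.map-[]≔ φ M i) ⟨
    a * D (map φ (M [ i ]≔ x)) + D (map φ (M [ i ]≔ y)) ∎

  combination-multilinear : ∀ {n w} {D D′ : Rows n w → Carrier} a →
    Multilinear D → Multilinear D′ → Multilinear (λ M → a * D M + D′ M)
  combination-multilinear a D D′ .rows-cong M≋N =
    +-cong (*-congˡ (D .rows-cong M≋N)) (D′ .rows-cong M≋N)
  combination-multilinear {D = D} {D′} a D-lin D′-lin .row-linear M i b x y = trans
    (+-cong (*-congˡ (D-lin .row-linear M i b x y)) (D′-lin .row-linear M i b x y))
    (solve 6 (λ a b p q r s → a :* (b :* p :+ q) :+ (b :* r :+ s)
                           := b :* (a :* p :+ r) :+ (a :* q :+ s))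
       refl a b (D (M [ i ]≔ x)) (D (M [ i ]≔ y)) (D′ (M [ i ]≔ x)) (D′ (M [ i ]≔ y)))

  -- Expanding the first row and recursing with a unit vector fixed in its place reduces to matrices
  -- whose rows are all unit vectors, encoded by their positions `f`.
  multilinear-ext-0 : ∀ {n w} {D : Rows n w → Carrier} → Multilinear D →
                      (∀ (f : Vec (Fin w) n) → D (map basis f) ≈ 0#) → ∀ M → D M ≈ 0#
  multilinear-ext-0 D-lin D≈0 []      = D≈0 []
  multilinear-ext-0 {D = D} D-lin D≈0 (x ∷ M) = begin
    D (x ∷ M)
      ≈⟨ linear-expand (at D-lin (x ∷ M) zero) x ⟩
    sum (λ j → x j * D (basis j ∷ M))
      ≈⟨ sum-zero (λ j → trans
           (*-congˡ (multilinear-ext-0 (∷-multilinear D-lin (basis j)) (λ f → D≈0 (j ∷ f)) M))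
           (zeroʳ (x j))) ⟩
    0# ∎

  Alternating : ∀ {n w} → (Rows n w → Carrier) → Set (c Level.⊔ e)
  Alternating D = ∀ M {i j} → i ≢ j → lookup M i ≋ lookup M j → D M ≈ 0#

  -- The property that passes through the Laplace expansion: for adjacent equal rows, the two minors
  -- that have to cancel agree without any permutation of rows.
  AdjacentAlternating : ∀ {n w} → (Rows n w → Carrier) → Set (c Level.⊔ e)
  AdjacentAlternating D =
    ∀ M {i j} → toℕ j ≡ suc (toℕ i) → lookup M i ≋ lookup M j → D M ≈ 0#

  -- The usual sign rule B y x = - B x y, with the sign irrelevant because only
  -- vanishing is transported.
  polarize : ∀ {w} {B : Row w → Row w → Carrier} →
             (∀ y → Linear (λ x → B x y)) → (∀ x → Linear (B x)) →
             (∀ x → B x x ≈ 0#) → ∀ x y → B x y ≈ 0# → B y x ≈ 0#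
  polarize {B = B} linˡ linʳ alt x y Bxy≈0 = begin
    B y x
      ≈⟨ *-identityˡ (B y x) ⟨
    1# * B y x
      ≈⟨ +-identityʳ _ ⟨
    1# * B y x + 0#
      ≈⟨ +-congˡ (alt x) ⟨
    1# * B y x + B x x
      ≈⟨ linˡ x .linear 1# y x ⟨
    B z x
      ≈⟨ trans (sym (*-identityˡ _)) (sym (+-identityʳ _)) ⟩
    1# * B z x + 0#
      ≈⟨ +-congˡ Bzy≈0 ⟨
    1# * B z x + B z y
      ≈⟨ linʳ z .linear 1# x y ⟨
    B z (1# · x ⊕ y)
      ≈⟨ linʳ z .cong (λ j → trans (+-comm _ _) (+-cong (sym (*-identityˡ _)) (*-identityˡ _))) ⟩
    B z z
      ≈⟨ alt z ⟩
    0# ∎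
    where
    z : Row _
    z = 1# · y ⊕ x

    Bzy≈0 : B z y ≈ 0#
    Bzy≈0 = begin
      B z y              ≈⟨ linˡ y .linear 1# y x ⟩
      1# * B y y + B x y ≈⟨ +-cong (*-identityˡ _) Bxy≈0 ⟩
      B y y + 0#         ≈⟨ +-identityʳ _ ⟩
      B y y              ≈⟨ alt y ⟩
      0#                 ∎

  -- Rows above the equal pair are fixed one at a time until the pair involves the head row. That
  -- row is then moved down towards its copy by adjacent swaps, and `polarize` carries the vanishing
  -- back through each swap.
  adjacent⇒alternating : ∀ {n w} {D : Rows n w → Carrier} → Multilinear D →
                         AdjacentAlternating D → Alternating D
  adjacent⇒alternating {D = D} D-lin D-adj (x ∷ M) {zero}  {zero}  i≢j _ = contradiction ≡.refl i≢j
  adjacent⇒alternating {D = D} D-lin D-adj (x ∷ M) {zero}  {suc j} _   = head-case D-lin D-adj x M j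
    where
    head-case : ∀ {n w} {D : Rows (suc n) w → Carrier} → Multilinear D → AdjacentAlternating D →
                ∀ x M j → x ≋ lookup M j → D (x ∷ M) ≈ 0#
    head-case D-lin D-adj x (y ∷ M) zero    x≋y  = D-adj (x ∷ y ∷ M) {zero} {suc zero} ≡.refl x≋y
    head-case {D = D} D-lin D-adj x (y ∷ M) (suc j) x≋Mⱼ = polarize {B = λ x y → D (x ∷ y ∷ M)}
      (λ y → at D-lin (x ∷ y ∷ M) zero)
      (λ x → at D-lin (x ∷ y ∷ M) (suc zero))
      (λ x → D-adj (x ∷ x ∷ M) {zero} {suc zero} ≡.refl (λ _ → refl))
      y x
      (head-case (∷-multilinear D-lin y)
        (λ M {i} {j} j≡1+i → D-adj (y ∷ M) {suc i} {suc j} (≡.cong suc j≡1+i))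
        x M j x≋Mⱼ)
  adjacent⇒alternating {D = D} D-lin D-adj (x ∷ M) {suc i} {zero} _ Mᵢ≋x =
    adjacent⇒alternating D-lin D-adj (x ∷ M) {zero} {suc i} (λ ()) (λ k → sym (Mᵢ≋x k))
  adjacent⇒alternating {D = D} D-lin D-adj (x ∷ M) {suc i} {suc j} i≢j =
    adjacent⇒alternating (∷-multilinear D-lin x)
      (λ M {i} {j} j≡1+i → D-adj (x ∷ M) {suc i} {suc j} (≡.cong suc j≡1+i)) M (i≢j ∘ ≡.cong suc)

  -- Laplace expansion of an arbitrary form

  -- The column-0 expansion in which an arbitrary form G evaluates the minors; deleting
  -- a later row leaves row x in the minor, which is what G ∘ (tl x ∷_) expresses.
  laplace : ∀ {n w} → (Rows n w → Carrier) → Rows (suc n) (suc w) → Carrier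
  laplace {zero}  G (x ∷ []) = x zero * G []
  laplace {suc n} G (x ∷ M)  = x zero * G (map tl M) + -1# * laplace (G ∘ (tl x ∷_)) M

  laplace-cong : ∀ {n w} {G H : Rows n w → Carrier} → (∀ M → G M ≈ H M) →
                 ∀ M → laplace G M ≈ laplace H M
  laplace-cong {zero}  G≈H (x ∷ []) = *-congˡ (G≈H [])
  laplace-cong {suc n} G≈H (x ∷ M)  =
    +-cong (*-congˡ (G≈H _)) (*-congˡ (laplace-cong (λ N → G≈H (tl x ∷ N)) M))

  -- Linearity in the form is what linearity in row 0 requires: row 0 enters the later minors
  -- through the form `G ∘ (tl x ∷_)`, so varying the row varies the form.
  laplace-combination : ∀ {n w} (G H : Rows n w → Carrier) a M →
    laplace (λ N → a * G N + H N) M ≈ a * laplace G M + laplace H M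
  laplace-combination {zero}  G H a (x ∷ []) =
    solve 4 (λ x a g h → x :* (a :* g :+ h) := a :* (x :* g) :+ x :* h) refl (x zero) a (G []) (H [])
  laplace-combination {suc n} G H a (x ∷ M) = trans
    (+-congˡ (*-congˡ (laplace-combination (G ∘ (tl x ∷_)) (H ∘ (tl x ∷_)) a M)))
    (solve 7 (λ x s a g h p q → x :* (a :* g :+ h) :+ s :* (a :* p :+ q)
                             := a :* (x :* g :+ s :* p) :+ (x :* h :+ s :* q))
       refl (x zero) -1# a (G (map tl M)) (H (map tl M))
       (laplace (G ∘ (tl x ∷_)) M) (laplace (H ∘ (tl x ∷_)) M))

  laplace-zero : ∀ {n w} {G : Rows n w → Carrier} → (∀ N → G N ≈ 0#) → ∀ M → laplace G M ≈ 0#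
  laplace-zero {zero}  G≈0 (x ∷ []) = trans (*-congˡ (G≈0 [])) (zeroʳ _)
  laplace-zero {suc n} G≈0 (x ∷ M)  = trans
    (+-cong (trans (*-congˡ (G≈0 _)) (zeroʳ _))
            (trans (*-congˡ (laplace-zero (λ N → G≈0 (tl x ∷ N)) M)) (zeroʳ _)))
    (+-identityˡ 0#)

  laplace-multilinear : ∀ {n w} {G : Rows n w → Carrier} → Multilinear G → Multilinear (laplace G)
  laplace-multilinear {zero} G .rows-cong {x ∷ []} {y ∷ []} M≋N = *-congʳ (M≋N zero zero)
  laplace-multilinear {suc n} {G = G} G-lin .rows-cong {x ∷ M} {y ∷ N} M≋N = +-cong
    (*-cong (M≋N zero zero) (G-lin .rows-cong (map-tl-cong {M = M} {N} (M≋N ∘ suc))))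
    (*-congˡ (trans
      (laplace-cong (λ K → G-lin .rows-cong
        (∷-cong {M = K} (λ j → M≋N zero (suc j)) (≋ᴹ-refl {M = K}))) M)
      (laplace-multilinear (∷-multilinear G-lin (tl y)) .rows-cong (M≋N ∘ suc))))
  laplace-multilinear {zero} {G = G} G-lin .row-linear (z ∷ []) zero a x y =
    solve 4 (λ a x y g → (a :* x :+ y) :* g := a :* (x :* g) :+ y :* g)
      refl a (x zero) (y zero) (G [])
  laplace-multilinear {suc n} {G = G} G-lin .row-linear (z ∷ M) zero a x y = trans
    (+-congˡ (*-congˡ (trans
      (laplace-cong (λ N → at G-lin (tl x ∷ N) zero .linear a (tl x) (tl y)) M)
      (laplace-combination (G ∘ (tl x ∷_)) (G ∘ (tl y ∷_)) a M))))
    (solve 7 (λ a x y g s p q → (a :* x :+ y) :* g :+ s :* (a :* p :+ q)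
                             := a :* (x :* g :+ s :* p) :+ (y :* g :+ s :* q))
       refl a (x zero) (y zero) (G (map tl M)) -1#
       (laplace (G ∘ (tl x ∷_)) M) (laplace (G ∘ (tl y ∷_)) M))
  laplace-multilinear {suc n} {G = G} G-lin .row-linear (z ∷ M) (suc i) a x y = trans
    (+-cong (*-congˡ (map-multilinear {φ = tl} G-lin (λ j → proj-linear (suc j)) .row-linear M i a x y))
            (*-congˡ (laplace-multilinear (∷-multilinear G-lin (tl z)) .row-linear M i a x y)))
    (solve 7 (λ z a s g h p q → z :* (a :* g :+ h) :+ s :* (a :* p :+ q)
                             := a :* (z :* g :+ s :* p) :+ (z :* h :+ s :* q))
       refl (z zero) a -1#
       (G (map tl (M [ i ]≔ x))) (G (map tl (M [ i ]≔ y)))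
       (laplace (G ∘ (tl z ∷_)) (M [ i ]≔ x)) (laplace (G ∘ (tl z ∷_)) (M [ i ]≔ y)))

  -- If rows 0 and 1 agree, the minors deleting them are equal and carry opposite signs, while every
  -- other minor still contains both rows and vanishes. If the pair lies lower, the minor deleting
  -- row 0 contains it, and the remaining terms are covered by induction.
  laplace-adjacent : ∀ {n w} {G : Rows n w → Carrier} → Multilinear G →
                     AdjacentAlternating G → AdjacentAlternating (laplace G)
  laplace-adjacent {zero}  G-lin G-adj (x ∷ [])    {zero} {zero} ()
  laplace-adjacent {suc n} G-lin G-adj (x ∷ M)     {i} {zero} ()
  laplace-adjacent {suc zero} {G = G} G-lin G-adj (x ∷ y ∷ []) {zero} {suc zero} _ x≋y = begin
    x zero * G (tl y ∷ []) + -1# * (y zero * G (tl x ∷ []))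
      ≈⟨ +-congˡ (*-congˡ (*-cong (sym (x≋y zero)) (G-lin .rows-cong (∷-cong (x≋y ∘ suc) (λ ()))))) ⟩
    x zero * G (tl y ∷ []) + -1# * (x zero * G (tl y ∷ []))
      ≈⟨ x+-1*x≈0 _ ⟩
    0# ∎
  laplace-adjacent {suc (suc n)} {G = G} G-lin G-adj (x ∷ y ∷ M) {zero} {suc zero} _ x≋y = begin
    x zero * G (tl y ∷ map tl M) + -1# * (y zero * G (tl x ∷ map tl M) + -1# * L)
      ≈⟨ +-congˡ (*-congˡ (+-cong
           (*-cong (sym (x≋y zero))
             (G-lin .rows-cong (∷-cong (x≋y ∘ suc) (≋ᴹ-refl {M = map tl M}))))
           (trans (*-congˡ L≈0) (zeroʳ _)))) ⟩
    x zero * G (tl y ∷ map tl M) + -1# * (x zero * G (tl y ∷ map tl M) + 0#)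
      ≈⟨ +-congˡ (*-congˡ (+-identityʳ _)) ⟩
    x zero * G (tl y ∷ map tl M) + -1# * (x zero * G (tl y ∷ map tl M))
      ≈⟨ x+-1*x≈0 _ ⟩
    0# ∎
    where
    L = laplace (G ∘ (tl x ∷_) ∘ (tl y ∷_)) M

    L≈0 : L ≈ 0#
    L≈0 = laplace-zero (λ N → G-adj (tl x ∷ tl y ∷ N) {zero} {suc zero} ≡.refl (x≋y ∘ suc)) M
  laplace-adjacent {suc (suc n)} G-lin G-adj (x ∷ M) {zero} {suc (suc j)} ()
  laplace-adjacent {suc n} {G = G} G-lin G-adj (x ∷ M) {suc i} {suc j} j≡1+i Mᵢ≋Mⱼ = begin
    x zero * G (map tl M) + -1# * laplace (G ∘ (tl x ∷_)) M
      ≈⟨ +-cong (*-congˡ (G-adj (map tl M) (ℕ.suc-injective j≡1+i) tl-eq))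
                (*-congˡ (laplace-adjacent (∷-multilinear G-lin (tl x))
                   (λ N {k} {l} l≡1+k → G-adj (tl x ∷ N) {suc k} {suc l} (≡.cong suc l≡1+k))
                   M (ℕ.suc-injective j≡1+i) Mᵢ≋Mⱼ)) ⟩
    x zero * 0# + -1# * 0# ≈⟨ +-cong (zeroʳ _) (zeroʳ _) ⟩
    0# + 0#                ≈⟨ +-identityˡ 0# ⟩
    0#                     ∎
    where
    tl-eq : lookup (map tl M) i ≋ lookup (map tl M) j
    tl-eq k rewrite Vec.lookup-map i tl M | Vec.lookup-map j tl M = Mᵢ≋Mⱼ (suc k)

  -- Only terms deleting row i contribute, as every other minor retains a zero row.
  laplace-basis-row : ∀ {n w} {G : Rows n w → Carrier} → Multilinear G →
    ∀ (M : Fin (suc n) → Row (suc w)) i →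
    laplace G (tabulate M [ i ]≔ basis zero)
      ≈ -1# ^ toℕ i * G (tabulate (tl ∘ M ∘ punchIn i))
  laplace-basis-row {zero} G-lin M zero = refl
  laplace-basis-row {suc n} {G = G} G-lin M zero = begin
    1# * G (map tl (tabulate (M ∘ suc)))
      + -1# * laplace (G ∘ (tl (basis zero) ∷_)) (tabulate (M ∘ suc))
      ≈⟨ +-congˡ (*-congˡ (laplace-zero
           (λ N → zero-row G-lin (tl (basis zero) ∷ N) zero (λ _ → refl)) (tabulate (M ∘ suc)))) ⟩
    1# * G (map tl (tabulate (M ∘ suc))) + -1# * 0#
      ≈⟨ +-congˡ (zeroʳ _) ⟩
    1# * G (map tl (tabulate (M ∘ suc))) + 0#
      ≈⟨ +-identityʳ _ ⟩
    1# * G (map tl (tabulate (M ∘ suc)))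
      ≡⟨ ≡.cong (λ N → 1# * G N) (Vec.tabulate-∘ tl (M ∘ suc)) ⟨
    1# * G (tabulate (tl ∘ M ∘ suc)) ∎
  laplace-basis-row {suc n} {G = G} G-lin M (suc i) = begin
    M zero zero * G (map tl (tabulate (M ∘ suc) [ i ]≔ basis zero))
      + -1# * laplace (G ∘ (tl (M zero) ∷_)) (tabulate (M ∘ suc) [ i ]≔ basis zero)
      ≈⟨ +-cong (trans (*-congˡ (trans
                   (reflexive (≡.cong G (Vec.map-[]≔ tl (tabulate (M ∘ suc)) i)))
                   (zero-row G-lin _ i λ j → reflexive
                     (≡.cong (λ r → r j) (Vec.lookup∘update i (map tl (tabulate (M ∘ suc))) (tl (basis zero)))))))
                 (zeroʳ _))
               (*-congˡ (laplace-basis-row (∷-multilinear G-lin (tl (M zero))) (M ∘ suc) i)) ⟩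
    0# + -1# * (-1# ^ toℕ i * G (tl (M zero) ∷ tabulate (tl ∘ M ∘ suc ∘ punchIn i)))
      ≈⟨ trans (+-identityˡ _) (sym (*-assoc _ _ _)) ⟩
    (-1# * -1# ^ toℕ i) * G (tl (M zero) ∷ tabulate (tl ∘ M ∘ suc ∘ punchIn i)) ∎

  -- The recursion collects one factor `-1#` per row passed, which accumulates to the power
  -- `-1# ^ toℕ i` of the explicit cofactor sum.
  laplace-sum : ∀ {n w} (G : Rows n w → Carrier) (M : Fin (suc n) → Row (suc w)) →
    sum (λ i → M i zero * (-1# ^ toℕ i * G (tabulate (tl ∘ M ∘ punchIn i))))
      ≈ laplace G (tabulate M)
  laplace-sum {zero}  G M = trans (+-identityʳ _) (*-congˡ (*-identityˡ _))
  laplace-sum {suc n} G M = +-cong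
    (*-congˡ (trans (*-identityˡ _) (reflexive (≡.cong G (Vec.tabulate-∘ tl (M ∘ suc))))))
    (begin
      sum (λ i → M (suc i) zero * ((-1# * -1# ^ toℕ i) * G′ (tabulate (tl ∘ M ∘ suc ∘ punchIn i))))
        ≈⟨ sum-cong-≋ (λ i → solve 4 (λ m s t g → m :* ((s :* t) :* g) := s :* (m :* (t :* g)))
             refl (M (suc i) zero) -1# (-1# ^ toℕ i) (G′ (tabulate (tl ∘ M ∘ suc ∘ punchIn i)))) ⟩
      sum (λ i → -1# * (M (suc i) zero * (-1# ^ toℕ i * G′ (tabulate (tl ∘ M ∘ suc ∘ punchIn i)))))
        ≈⟨ *-distribˡ-sum -1# (λ i → M (suc i) zero * (-1# ^ toℕ i * G′ (tabulate (tl ∘ M ∘ suc ∘ punchIn i)))) ⟨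
      -1# * sum (λ i → M (suc i) zero * (-1# ^ toℕ i * G′ (tabulate (tl ∘ M ∘ suc ∘ punchIn i))))
        ≈⟨ *-congˡ (laplace-sum G′ (M ∘ suc)) ⟩
      -1# * laplace G′ (tabulate (M ∘ suc)) ∎)
    where
    G′ = G ∘ (tl (M zero) ∷_)

  -- The determinant as an alternating form on rows

  detʳ : ∀ {n} → Rows n n → Carrier
  detʳ {zero}  _ = 1#
  detʳ {suc n}   = laplace detʳ

  detʳ-multilinear : ∀ {n} → Multilinear (detʳ {n})
  detʳ-multilinear {zero}  = record { rows-cong = λ _ → refl ; row-linear = λ _ () }
  detʳ-multilinear {suc n} = laplace-multilinear detʳ-multilinear

  detʳ-adjacent : ∀ {n} → AdjacentAlternating (detʳ {n})
  detʳ-adjacent {zero}  M {()}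
  detʳ-adjacent {suc n} = laplace-adjacent detʳ-multilinear detʳ-adjacent

  detʳ-alternating : ∀ {n} → Alternating (detʳ {n})
  detʳ-alternating = adjacent⇒alternating detʳ-multilinear detʳ-adjacent

  rows-≋ : ∀ {n w} {M N : Fin n → Row w} → (∀ i → M i ≋ N i) → tabulate M ≋ᴹ tabulate N
  rows-≋ {M = M} {N} M≋N i j
    rewrite Vec.lookup∘tabulate M i | Vec.lookup∘tabulate N i = M≋N i j

  laplace-basis-head : ∀ {n w} {G : Rows n w → Carrier} → Multilinear G →
    ∀ {x : Row (suc w)} M → x ≋ basis zero → laplace G (x ∷ M) ≈ G (map tl M)
  laplace-basis-head {zero} G-lin [] x≋ = trans (*-congʳ (x≋ zero)) (*-identityˡ _)
  laplace-basis-head {suc n} {G = G} G-lin {x} M x≋ = begin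
    x zero * G (map tl M) + -1# * laplace (G ∘ (tl x ∷_)) M
      ≈⟨ +-cong (*-congʳ (x≋ zero))
           (*-congˡ (laplace-zero (λ N → zero-row G-lin (tl x ∷ N) zero (λ j → x≋ (suc j))) M)) ⟩
    1# * G (map tl M) + -1# * 0#
      ≈⟨ trans (+-cong (*-identityˡ _) (zeroʳ _)) (+-identityʳ _) ⟩
    G (map tl M) ∎

  tl-basis : ∀ {w} (i : Fin w) → tl (basis (suc i)) ≋ basis i
  tl-basis i j with i Fin.≟ j
  ... | yes _ = refl
  ... | no  _ = refl

  detʳ-1 : ∀ n → detʳ (tabulate (basis {n})) ≈ 1#
  detʳ-1 zero    = refl
  detʳ-1 (suc n) = begin
    laplace detʳ (basis zero ∷ rest)
      ≈⟨ laplace-basis-head (detʳ-multilinear {n}) rest (λ _ → refl) ⟩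
    detʳ {n} (map tl rest)
      ≡⟨ ≡.cong (detʳ {n}) (Vec.tabulate-∘ tl (basis ∘ suc)) ⟨
    detʳ {n} (tabulate (tl ∘ basis ∘ suc))
      ≈⟨ detʳ-multilinear {n} .rows-cong
           {M = tabulate (tl ∘ basis ∘ suc)} {tabulate basis} (rows-≋ {M = tl ∘ basis ∘ suc} tl-basis) ⟩
    detʳ {n} (tabulate (basis {n}))
      ≈⟨ detʳ-1 n ⟩
    1# ∎
    where
    rest : Rows n (suc n)
    rest = tabulate (basis ∘ suc)

  -- Uniqueness of the determinant

  -- On unit rows this is selection sort. Asking only for vanishing means that no signs of
  -- permutations have to be tracked.
  alternating-ext-0 : ∀ {n} {D : Rows n n → Carrier} → Multilinear D → Alternating D →
                      D (tabulate basis) ≈ 0# → ∀ M → D M ≈ 0#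
  alternating-ext-0 {zero}  D-lin D-alt D1≈0 [] = D1≈0
  alternating-ext-0 {suc n} {D} D-lin D-alt D1≈0 =
    -- The argument `d` counts the positions still to be put in order; at `d = 0` the rows are those
    -- of the identity.
    multilinear-ext-0 D-lin λ f → sort f (suc n) 0 (ℕ.+-identityʳ _) λ _ ()
    where
    -- f is the identity below t.  Either f takes the value t, which is swapped into
    -- place, or f misses t and so repeats a value.
    sort : ∀ f d t → d ℕ.+ t ≡ suc n → (∀ i → toℕ i ℕ.< t → lookup f i ≡ i) →
           D (map basis f) ≈ 0#
    sort f zero t t≡1+n f-id = trans (reflexive (≡.cong D map-basis≡)) D1≈0
      where
      map-basis≡ : map basis f ≡ tabulate basis
      map-basis≡ = ≡.trans (≡.cong (map basis) (≡.sym (Vec.tabulate∘lookup f)))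
        (≡.trans (≡.sym (Vec.tabulate-∘ basis (lookup f)))
          (Vec.tabulate-cong λ i → ≡.cong basis (f-id i (≡.subst (toℕ i ℕ.<_) (≡.sym t≡1+n) (Fin.toℕ<n i)))))
    sort f (suc d) t d+t≡n f-id = by-preimage (Fin.any? λ s → lookup f s Fin.≟ t′)
      where
      t<1+n : t ℕ.< suc n
      t<1+n = ℕ.≤-trans (ℕ.s≤s (ℕ.m≤n+m t d)) (ℕ.≤-reflexive d+t≡n)

      t′ : Fin (suc n)
      t′ = Fin.fromℕ< t<1+n

      toℕ-t′ : toℕ t′ ≡ t
      toℕ-t′ = Fin.toℕ-fromℕ< t<1+n

      next : ∀ g → lookup g t′ ≡ t′ → (∀ i → toℕ i ℕ.< t → lookup g i ≡ i) → D (map basis g) ≈ 0#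
      next g gₜ≡t g-id = sort g d (suc t) (≡.trans (ℕ.+-suc d t) d+t≡n) λ i i<1+t →
        [ g-id i
        , (λ i≡t → ≡.subst (λ k → lookup g k ≡ k) (Fin.toℕ-injective (≡.trans toℕ-t′ (≡.sym i≡t))) gₜ≡t)
        ] (ℕ.m≤n⇒m<n∨m≡n (ℕ.s≤s⁻¹ i<1+t))

      M : Rows (suc n) (suc n)
      M = map basis f

      module Swap (s : Fin (suc n)) (fₛ≡t : lookup f s ≡ t′) (s≢t : s ≢ t′) where
        B : Row (suc n) → Row (suc n) → Carrier
        B x y = D (M [ s ]≔ x [ t′ ]≔ y)

        g : Vec (Fin (suc n)) (suc n)
        g = f [ s ]≔ lookup f t′ [ t′ ]≔ lookup f s

        restore : M [ s ]≔ basis (lookup f s) [ t′ ]≔ basis (lookup f t′) ≡ M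
        restore = ≡.trans
          (≡.cong₂ (λ x y → M [ s ]≔ x [ t′ ]≔ y)
            (≡.sym (Vec.lookup-map s basis f)) (≡.sym (Vec.lookup-map t′ basis f)))
          (≡.trans (≡.cong (_[ t′ ]≔ lookup M t′) (Vec.[]≔-lookup M s)) (Vec.[]≔-lookup M t′))

        linearʳ : ∀ x → Linear (B x)
        linearʳ x = at D-lin (M [ s ]≔ x) t′

        commute : ∀ {x y} → B x y ≈ D (M [ t′ ]≔ y [ s ]≔ x)
        commute = reflexive (≡.cong D (Vec.[]≔-commutes M s t′ s≢t))

        linearˡ : ∀ y → Linear (λ x → B x y)
        linearˡ y .cong x≋x′ =
          trans commute (trans (at D-lin (M [ t′ ]≔ y) s .cong x≋x′) (sym commute))
        linearˡ y .linear a x x′ =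
          trans commute (trans (at D-lin (M [ t′ ]≔ y) s .linear a x x′)
            (+-cong (*-congˡ (sym commute)) (sym commute)))

        alternating : ∀ x → B x x ≈ 0#
        alternating x = D-alt (M [ s ]≔ x [ t′ ]≔ x) s≢t λ j → reflexive (≡.cong (λ r → r j)
          (≡.trans (Vec.lookup∘update′ s≢t (M [ s ]≔ x) x)
            (≡.trans (Vec.lookup∘update s M x) (≡.sym (Vec.lookup∘update t′ (M [ s ]≔ x) x)))))

        -- The swap leaves the sorted part alone: `s` is not below `t`, since `f` fixes everything
        -- there whereas it sends `s` to `t`.
        g-id : ∀ i → toℕ i ℕ.< t → lookup g i ≡ i
        g-id i i<t = ≡.trans (Vec.lookup∘update′ i≢t (f [ s ]≔ lookup f t′) (lookup f s))
          (≡.trans (Vec.lookup∘update′ i≢s f (lookup f t′)) (f-id i i<t))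
          where
          i≢t : i ≢ t′
          i≢t i≡t = ℕ.<-irrefl (≡.trans (≡.cong toℕ i≡t) toℕ-t′) i<t

          i≢s : i ≢ s
          i≢s i≡s = i≢t (≡.trans (≡.sym (f-id i i<t)) (≡.trans (≡.cong (lookup f) i≡s) fₛ≡t))

        swapped≈0 : B (basis (lookup f t′)) (basis (lookup f s)) ≈ 0#
        swapped≈0 = trans
          (reflexive (≡.cong D (≡.sym (≡.trans
            (Vec.map-[]≔ basis (f [ s ]≔ lookup f t′) t′)
            (≡.cong (_[ t′ ]≔ basis (lookup f s)) (Vec.map-[]≔ basis f s))))))
          (next g (≡.trans (Vec.lookup∘update t′ (f [ s ]≔ lookup f t′) (lookup f s)) fₛ≡t) g-id)

      by-preimage : Dec (Σ[ s ∈ Fin (suc n) ] lookup f s ≡ t′) → D M ≈ 0#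
      by-preimage (yes (s , fₛ≡t)) with s Fin.≟ t′
      ... | yes s≡t = next f (≡.trans (≡.cong (lookup f) (≡.sym s≡t)) fₛ≡t) f-id
      ... | no s≢t  = trans (reflexive (≡.cong D (≡.sym restore)))
        (polarize linearˡ linearʳ alternating (basis (lookup f t′)) (basis (lookup f s)) swapped≈0)
        where open Swap s fₛ≡t s≢t
      -- Punching the missed value `t` out of the range squeezes `suc n` arguments into `n` values,
      -- so two rows coincide.
      by-preimage (no t∉f)
        with i , j , i<j , eq ← Fin.pigeonhole (ℕ.n<1+n n)
               (λ s → punchOut {i = t′} {j = lookup f s} (λ t≡fₛ → t∉f (s , ≡.sym t≡fₛ))) =
        D-alt M (Fin.<⇒≢ i<j) λ k → reflexive (≡.cong (λ r → r k)
          (≡.trans (Vec.lookup-map i basis f)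
            (≡.trans (≡.cong basis (Fin.punchOut-injective {i = t′} _ _ eq))
              (≡.sym (Vec.lookup-map j basis f)))))

  -- The difference of the two sides is again multilinear and alternating in `M`, and it vanishes at
  -- the identity.
  alternating-unique : ∀ {n} {D : Rows n n → Carrier} → Multilinear D → Alternating D →
                       ∀ M → D M ≈ detʳ M * D (tabulate basis)
  alternating-unique {n} {D} D-lin D-alt M = x∙y⁻¹≈ε⇒x≈y (D M) (detʳ M * D1) (begin
    D M - detʳ M * D1     ≈⟨ +-congˡ (-‿cong (*-comm _ _)) ⟩
    D M - D1 * detʳ M     ≈⟨ +-congˡ (-‿distribˡ-* _ _) ⟩
    D M + - D1 * detʳ M   ≈⟨ +-comm _ _ ⟩
    - D1 * detʳ M + D M   ≈⟨ difference≈0 ⟩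
    0#                    ∎)
    where
    D1 = D (tabulate basis)

    difference≈0 : - D1 * detʳ M + D M ≈ 0#
    difference≈0 = alternating-ext-0
      (combination-multilinear (- D1) detʳ-multilinear D-lin)
      (λ N i≢j Nᵢ≋Nⱼ → trans
        (+-cong (trans (*-congˡ (detʳ-alternating N i≢j Nᵢ≋Nⱼ)) (zeroʳ _)) (D-alt N i≢j Nᵢ≋Nⱼ))
        (+-identityˡ 0#))
      (trans (+-congʳ (trans (*-congˡ (detʳ-1 n)) (*-identityʳ _))) (-‿inverseˡ _))
      M

  map-alternating : ∀ {n v w} {D : Rows n w → Carrier} {φ : Row v → Row w} →
                    Alternating D → LinearMap φ → Alternating (D ∘ map φ)
  map-alternating {φ = φ} D-alt φ-lin M {i} {j} i≢j Mᵢ≋Mⱼ = D-alt (map φ M) i≢j λ k → begin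
    lookup (map φ M) i k ≡⟨ ≡.cong (λ r → r k) (Vec.lookup-map i φ M) ⟩
    φ (lookup M i) k     ≈⟨ φ-lin k .cong Mᵢ≋Mⱼ ⟩
    φ (lookup M j) k     ≡⟨ ≡.cong (λ r → r k) (Vec.lookup-map j φ M) ⟨
    lookup (map φ M) j k ∎

  -- Multiplicativity of the determinant, with the right factor given as a linear map: applying `φ`
  -- to every row before taking the determinant is an alternating form in `M`.
  detʳ-map : ∀ {n} {φ : Row n → Row n} → LinearMap φ → ∀ (M : Fin n → Row n) →
             detʳ (tabulate (φ ∘ M)) ≈ detʳ (tabulate M) * detʳ (tabulate (φ ∘ basis))
  detʳ-map {φ = φ} φ-lin M = begin
    detʳ (tabulate (φ ∘ M))
      ≡⟨ ≡.cong detʳ (Vec.tabulate-∘ φ M) ⟩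
    detʳ (map φ (tabulate M))
      ≈⟨ alternating-unique (map-multilinear detʳ-multilinear φ-lin)
                            (map-alternating detʳ-alternating φ-lin) (tabulate M) ⟩
    detʳ (tabulate M) * detʳ (map φ (tabulate basis))
      ≡⟨ ≡.cong (λ N → detʳ (tabulate M) * detʳ N) (Vec.tabulate-∘ φ basis) ⟨
    detʳ (tabulate M) * detʳ (tabulate (φ ∘ basis)) ∎

  detʳ-cong : ∀ {n} {M N : Fin n → Row n} → (∀ i → M i ≋ N i) →
              detʳ (tabulate M) ≈ detʳ (tabulate N)
  detʳ-cong M≋N = detʳ-multilinear .rows-cong (rows-≋ M≋N)

  -- Block-diagonal determinants

  ++-congˡ : ∀ {n m w} {M N : Rows n w} {Q : Rows m w} → M ≋ᴹ N → (M Vec.++ Q) ≋ᴹ (N Vec.++ Q)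
  ++-congˡ {M = []}    {[]}        M≋N i       j = refl
  ++-congˡ {M = _ ∷ M} {_ ∷ N}     M≋N zero    j = M≋N zero j
  ++-congˡ {M = _ ∷ M} {_ ∷ N} {Q} M≋N (suc i) j = ++-congˡ {M = M} {N} {Q} (M≋N ∘ suc) i j

  ++-multilinear : ∀ {n m w} {D : Rows (n ℕ.+ m) w → Carrier} → Multilinear D →
                   ∀ (Q : Rows m w) → Multilinear (λ M → D (M Vec.++ Q))
  ++-multilinear D-lin Q .rows-cong {M} {N} M≋N = D-lin .rows-cong (++-congˡ {M = M} {N} {Q} M≋N)
  ++-multilinear {m = m} {D = D} D-lin Q .row-linear M i a x y = begin
    D (M [ i ]≔ (a · x ⊕ y) Vec.++ Q)
      ≡⟨ ≡.cong D (Vec.[]≔-++-↑ˡ M Q i) ⟨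
    D ((M Vec.++ Q) [ i ↑ˡ m ]≔ (a · x ⊕ y))
      ≈⟨ D-lin .row-linear (M Vec.++ Q) (i ↑ˡ m) a x y ⟩
    a * D ((M Vec.++ Q) [ i ↑ˡ m ]≔ x) + D ((M Vec.++ Q) [ i ↑ˡ m ]≔ y)
      ≡⟨ ≡.cong₂ (λ u v → a * D u + D v) (Vec.[]≔-++-↑ˡ M Q i) (Vec.[]≔-++-↑ˡ M Q i) ⟩
    a * D (M [ i ]≔ x Vec.++ Q) + D (M [ i ]≔ y Vec.++ Q) ∎

  ++-alternating : ∀ {n m w} {D : Rows (n ℕ.+ m) w → Carrier} → Alternating D →
                   ∀ (Q : Rows m w) → Alternating (λ M → D (M Vec.++ Q))
  ++-alternating {m = m} D-alt Q M {i} {j} i≢j Mᵢ≋Mⱼ =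
    D-alt (M Vec.++ Q) (i≢j ∘ Fin.↑ˡ-injective m i j) λ k → begin
      lookup (M Vec.++ Q) (i ↑ˡ m) k ≡⟨ ≡.cong (λ r → r k) (Vec.lookup-++ˡ M Q i) ⟩
      lookup M i k                   ≈⟨ Mᵢ≋Mⱼ k ⟩
      lookup M j k                   ≡⟨ ≡.cong (λ r → r k) (Vec.lookup-++ˡ M Q j) ⟨
      lookup (M Vec.++ Q) (j ↑ˡ m) k ∎

  tabulate-++-cong : ∀ {n m w} {M N : Fin n → Row w} {P Q : Fin m → Row w} →
            (∀ i → M i ≋ N i) → (∀ i → P i ≋ Q i) →
            (tabulate M Vec.++ tabulate P) ≋ᴹ (tabulate N Vec.++ tabulate Q)
  tabulate-++-cong {zero}  M≋N P≋Q i       j = rows-≋ P≋Q i j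
  tabulate-++-cong {suc n} M≋N P≋Q zero    j = M≋N zero j
  tabulate-++-cong {suc n} M≋N P≋Q (suc i) j = tabulate-++-cong (M≋N ∘ suc) P≋Q i j

  padʳ : ∀ {p m} → Row p → Row (p ℕ.+ m)
  padʳ x = x F.++ 0ʳ

  padˡ : ∀ {p m} → Row m → Row (p ℕ.+ m)
  padˡ {p} y = 0ʳ {p} F.++ y

  padʳ-linear : ∀ {p m} → LinearMap (padʳ {p} {m})
  padʳ-linear {p} j .cong x≋y with splitAt p j
  ... | inj₁ i = x≋y i
  ... | inj₂ _ = refl
  padʳ-linear {p} j .linear a x y with splitAt p j
  ... | inj₁ _ = refl
  ... | inj₂ _ = sym (trans (+-congʳ (zeroʳ a)) (+-identityˡ 0#))

  -- The first row is `e_0`, so expansion removes it together with column 0 and shortens the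
  -- identity block by one.
  detʳ-padded-1 : ∀ p {m} (Y : Fin m → Row m) →
    detʳ (tabulate (padʳ {p} {m} ∘ basis) Vec.++ tabulate (padˡ ∘ Y)) ≈ detʳ (tabulate Y)
  detʳ-padded-1 zero    Y = refl
  detʳ-padded-1 (suc p) {m} Y = begin
    detʳ {suc n} (padʳ {suc p} {m} (basis zero) ∷ (tabulate P Vec.++ tabulate Q))
      ≈⟨ laplace-basis-head (detʳ-multilinear {n}) (tabulate P Vec.++ tabulate Q) head-basis ⟩
    detʳ {n} (map tl (tabulate P Vec.++ tabulate Q))
      ≡⟨ ≡.cong (detʳ {n}) (≡.trans (Vec.map-++ tl (tabulate P) (tabulate Q))
           (≡.cong₂ Vec._++_ (≡.sym (Vec.tabulate-∘ tl P)) (≡.sym (Vec.tabulate-∘ tl Q)))) ⟩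
    detʳ {n} (tabulate (tl ∘ P) Vec.++ tabulate (tl ∘ Q))
      ≈⟨ detʳ-multilinear {n} .rows-cong
           {M = tabulate (tl ∘ P) Vec.++ tabulate (tl ∘ Q)}
           {tabulate (padʳ {p} {m} ∘ basis) Vec.++ tabulate (padˡ ∘ Y)}
           (tabulate-++-cong {M = tl ∘ P} tl-padʳ tl-padˡ) ⟩
    detʳ {n} (tabulate (padʳ {p} {m} ∘ basis) Vec.++ tabulate (padˡ ∘ Y))
      ≈⟨ detʳ-padded-1 p Y ⟩
    detʳ (tabulate Y) ∎
    where
    n = p ℕ.+ m

    P : Fin p → Row (suc n)
    P = padʳ {suc p} {m} ∘ basis ∘ suc

    Q : Fin m → Row (suc n)
    Q = padˡ {suc p} ∘ Y

    head-basis : padʳ {suc p} {m} (basis zero) ≋ basis zero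
    head-basis zero    = refl
    head-basis (suc j) with splitAt p j
    ... | inj₁ _ = refl
    ... | inj₂ _ = refl

    tl-padʳ : ∀ i → tl (padʳ {suc p} {m} (basis (suc i))) ≋ padʳ (basis i)
    tl-padʳ i j with splitAt p j
    ... | inj₁ l = tl-basis i l
    ... | inj₂ _ = refl

    tl-padˡ : ∀ i → tl (padˡ {suc p} (Y i)) ≋ padˡ (Y i)
    tl-padˡ i j with splitAt p j
    ... | inj₁ _ = refl
    ... | inj₂ _ = refl

  -- With the lower rows fixed, the determinant is an alternating form in `X`; uniqueness reduces it
  -- to its value at the identity block.
  detʳ-block-diagonal : ∀ {p m} (X : Fin p → Row p) (Y : Fin m → Row m) →
    detʳ (tabulate (padʳ {p} {m} ∘ X) Vec.++ tabulate (padˡ ∘ Y))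
      ≈ detʳ (tabulate X) * detʳ (tabulate Y)
  detʳ-block-diagonal {p} {m} X Y = begin
    detʳ (tabulate (padʳ ∘ X) Vec.++ Q)
      ≡⟨ ≡.cong (λ M → detʳ (M Vec.++ Q)) (Vec.tabulate-∘ padʳ X) ⟩
    D (tabulate X)
      ≈⟨ alternating-unique
           (map-multilinear (++-multilinear detʳ-multilinear Q) padʳ-linear)
           (map-alternating (++-alternating detʳ-alternating Q) padʳ-linear)
           (tabulate X) ⟩
    detʳ (tabulate X) * D (tabulate basis)
      ≡⟨ ≡.cong (λ M → detʳ (tabulate X) * detʳ (M Vec.++ Q)) (Vec.tabulate-∘ padʳ basis) ⟨
    detʳ (tabulate X) * detʳ (tabulate (padʳ ∘ basis) Vec.++ Q)
      ≈⟨ *-congˡ (detʳ-padded-1 p Y) ⟩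
    detʳ (tabulate X) * detʳ (tabulate Y) ∎
    where
    Q : Rows m (p ℕ.+ m)
    Q = tabulate (padˡ ∘ Y)

    D : Rows p p → Carrier
    D M = detʳ (map padʳ M Vec.++ Q)

  -- Cramer's rule

  -- The classical adjugate: the `(l,i)` cofactor stands at place `(i,l)`. Writing it as a
  -- determinant with row `l` replaced keeps it a value of a functional linear in that row.
  adjugate : ∀ {n} → (Fin n → Row n) → Fin n → Row n
  adjugate M i l = detʳ (tabulate M [ l ]≔ basis i)

  -- The left side is the expansion of the determinant with row `l` replaced by `M j`: the original
  -- determinant if `j = l`, and one with two equal rows otherwise.
  ⟨*⟩-adjugate : ∀ {n} (M : Fin n → Row n) j l →
                 (M j ⟨*⟩ adjugate M) l ≈ basis j l * detʳ (tabulate M)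
  ⟨*⟩-adjugate M j l = begin
    (M j ⟨*⟩ adjugate M) l
      ≈⟨ linear-expand (at detʳ-multilinear (tabulate M) l) (M j) ⟨
    detʳ (tabulate M [ l ]≔ M j)
      ≈⟨ row (j Fin.≟ l) ⟩
    basis j l * detʳ (tabulate M) ∎
    where
    row : Dec (j ≡ l) → detʳ (tabulate M [ l ]≔ M j) ≈ basis j l * detʳ (tabulate M)
    row (yes ≡.refl) = begin
      detʳ (tabulate M [ j ]≔ M j)
        ≡⟨ ≡.cong (λ x → detʳ (tabulate M [ j ]≔ x)) (Vec.lookup∘tabulate M j) ⟨
      detʳ (tabulate M [ j ]≔ lookup (tabulate M) j)
        ≡⟨ ≡.cong detʳ (Vec.[]≔-lookup (tabulate M) j) ⟩
      detʳ (tabulate M)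
        ≈⟨ trans (*-congʳ (basis-refl j)) (*-identityˡ _) ⟨
      basis j j * detʳ (tabulate M) ∎
    row (no j≢l) = begin
      detʳ (tabulate M [ l ]≔ M j)
        ≈⟨ detʳ-alternating _ j≢l (λ k → reflexive (≡.cong (λ r → r k) (≡.trans
             (Vec.lookup∘update′ j≢l (tabulate M) (M j)) (≡.trans (Vec.lookup∘tabulate M j)
               (≡.sym (Vec.lookup∘update l (tabulate M) (M j))))))) ⟩
      0#
        ≈⟨ trans (*-congʳ (basis-≢ j≢l)) (zeroˡ _) ⟨
      basis j l * detʳ (tabulate M) ∎

  scale-linear : ∀ {w} (l : Fin w) d → Linear (λ x → x l * d)
  scale-linear l d .cong x≋y     = *-congʳ (x≋y l)
  scale-linear l d .linear a x y =
    solve 4 (λ a x y d → (a :* x :+ y) :* d := a :* (x :* d) :+ y :* d) refl a (x l) (y l) d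

  -- Multiply `x M = e_i` on the right by the adjugate; then `x (M adj M)` is `x` times the
  -- determinant and `e_i adj M` is row `i` of the adjugate.
  cramer : ∀ {n} (M : Fin n → Row n) i x → (x ⟨*⟩ M) ≋ basis i →
           ∀ l → x l * detʳ (tabulate M) ≈ adjugate M i l
  cramer M i x xM≋ l = begin
    x l * detʳ (tabulate M)
      ≈⟨ linear-expand (scale-linear l (detʳ (tabulate M))) x ⟩
    sum (λ j → x j * (basis j l * detʳ (tabulate M)))
      ≈⟨ sum-cong-≋ (λ j → *-congˡ {x j} (⟨*⟩-adjugate M j l)) ⟨
    (x ⟨*⟩ (λ j → M j ⟨*⟩ adjugate M)) l
      ≈⟨ ⟨*⟩-assoc x M (adjugate M) l ⟨
    ((x ⟨*⟩ M) ⟨*⟩ adjugate M) l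
      ≈⟨ ⟨*⟩-linear (adjugate M) l .cong xM≋ ⟩
    (basis i ⟨*⟩ adjugate M) l
      ≈⟨ basis-⟨*⟩ i (adjugate M) l ⟩
    adjugate M i l ∎

-- Comparison with `det` and `cofactor`, and Cramer's rule over a field

module FieldDeterminants {c e} (K : Field c e) where
  open Field K
  open Matrices K
  open Determinants commutativeRing
  open import Algebra.Properties.Semiring.Exp semiring using (_^_)
  open import Algebra.Properties.Semiring.Sum semiring using (sum; sum-cong-≋)
  open import Relation.Binary.Reasoning.Setoid setoid

  det≈detʳ : ∀ {n} (M : Matrix n) → det M ≈ detʳ (tabulate M)

  cofactor≈ : ∀ {n} (M : Matrix (suc n)) i →
              cofactor M i zero ≈ -1# ^ toℕ i * detʳ (tabulate (tl ∘ M ∘ punchIn i))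
  cofactor≈ M i = *-cong
    (reflexive (≡.cong (-1# ^_) (ℕ.+-identityʳ (toℕ i))))
    (det≈detʳ (minor M i zero))

  det≈detʳ {zero}  M = refl
  det≈detʳ {suc n} M = trans (sum-cong-≋ λ i → *-congˡ {M i zero} (cofactor≈ M i)) (laplace-sum detʳ M)

  -- Cramer's rule for the right-hand side `e_0` produces determinants with row `i` replaced by
  -- `e_0`; this identifies them with the cofactors in column 0.
  cofactor≈adjugate : ∀ {n} (M : Matrix (suc n)) i → cofactor M i zero ≈ adjugate M zero i
  cofactor≈adjugate M i = trans (cofactor≈ M i) (sym (laplace-basis-row detʳ-multilinear M i))

  cramer₀ : ∀ {n} (M : Matrix (suc n)) x → (x ⟨*⟩ M) ≋ basis zero →
            ∀ l (d≉0 : det M ≉ 0#) → x l ≈ cofactor M l zero * det M ⁻¹[ d≉0 ]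
  cramer₀ M x xM≋ l d≉0 = begin
    x l                                   ≈⟨ *-identityʳ _ ⟨
    x l * 1#                              ≈⟨ *-congˡ (inverse (det M) d≉0) ⟨
    x l * (det M * det M ⁻¹[ d≉0 ])       ≈⟨ *-assoc _ _ _ ⟨
    x l * det M * det M ⁻¹[ d≉0 ]         ≈⟨ *-congʳ (*-congˡ (det≈detʳ M)) ⟩
    x l * detʳ (tabulate M) * det M ⁻¹[ d≉0 ] ≈⟨ *-congʳ (cramer M zero x xM≋ l) ⟩
    adjugate M zero l * det M ⁻¹[ d≉0 ]   ≈⟨ *-congʳ (cofactor≈adjugate M l) ⟨
    cofactor M l zero * det M ⁻¹[ d≉0 ]   ∎

-- N is k + 1, kept abstract because the factorization needs it in the form p + m.
module Folding {c e} (K : Field c e) (W : WeightedSet K)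
  (ω-even : ∀ s → Field._≈_ K (WeightedSet.ω W (ℤ.- s)) (WeightedSet.ω W s))
  (k : ℕ) {N : ℕ} (N≡1+k : N ≡ suc k) where
  open Field K
  open WeightedSet W
  open Matrices K
  open Transfer K W
  open Determinants commutativeRing
  open Linear
  open import Algebra.Properties.Ring ring using (-0#≈0#; -1*x≈-x; -‿+-comm)
  open import Algebra.Properties.AbelianGroup +-abelianGroup using (⁻¹-anti-homo‿-)
  open import Algebra.Solver.Ring.NaturalCoefficients.Default commutativeSemiring
    using (solve; _:+_; _:*_; _:=_)
  open import Relation.Binary.Reasoning.Setoid setoid

  -- Index ranges of the folded matrices and the reflection

  p m : ℕ
  p = suc ⌊ k /2⌋
  m = ⌈ k /2⌉

  2*n≡n+n : ∀ n → 2 ℕ.* n ≡ n ℕ.+ n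
  2*n≡n+n n = ≡.cong (n ℕ.+_) (ℕ.+-identityʳ n)

  2⌊n/2⌋≤n : ∀ n → 2 ℕ.* ⌊ n /2⌋ ℕ.≤ n
  2⌊n/2⌋≤n n = ℕ.≤-trans (ℕ.≤-reflexive (2*n≡n+n ⌊ n /2⌋))
    (ℕ.≤-trans (ℕ.+-monoʳ-≤ ⌊ n /2⌋ (ℕ.⌊n/2⌋≤⌈n/2⌉ n)) (ℕ.≤-reflexive (ℕ.⌊n/2⌋+⌈n/2⌉≡n n)))

  2j≤k : ∀ (j : Fin p) → 2 ℕ.* toℕ j ℕ.≤ k
  2j≤k j = ℕ.≤-trans (ℕ.*-monoʳ-≤ 2 (ℕ.s≤s⁻¹ (Fin.toℕ<n j))) (2⌊n/2⌋≤n k)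

  2j<k : ∀ (j : Fin m) → 2 ℕ.* toℕ j ℕ.< k
  2j<k j = ℕ.s≤s⁻¹ (≡.subst (ℕ._≤ suc k) (ℕ.*-suc 2 (toℕ j))
    (ℕ.≤-trans (ℕ.*-monoʳ-≤ 2 (Fin.toℕ<n j)) (2⌊n/2⌋≤n (suc k))))

  p≤N : p ℕ.≤ N
  p≤N = ≡.subst (p ℕ.≤_) (≡.sym N≡1+k) (ℕ.s≤s (ℕ.⌊n/2⌋≤n k))

  m≤N : m ℕ.≤ N
  m≤N = ≡.subst (m ℕ.≤_) (≡.sym N≡1+k) (ℕ.≤-trans (ℕ.⌈n/2⌉≤n k) (ℕ.n≤1+n k))

  i≤k : ∀ (i : Fin N) → toℕ i ℕ.≤ k
  i≤k i = ℕ.s≤s⁻¹ (≡.subst (toℕ i ℕ.<_) N≡1+k (Fin.toℕ<n i))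

  ι⁺ : Fin p → Fin N
  ι⁺ j = inject≤ j p≤N

  ι⁻ : Fin m → Fin N
  ι⁻ j = inject≤ j m≤N

  toℕ-ι⁺ : ∀ j → toℕ (ι⁺ j) ≡ toℕ j
  toℕ-ι⁺ j = Fin.toℕ-inject≤ j p≤N

  toℕ-ι⁻ : ∀ j → toℕ (ι⁻ j) ≡ toℕ j
  toℕ-ι⁻ j = Fin.toℕ-inject≤ j m≤N

  ρ : Fin N → Fin N
  ρ = opposite

  ρρ : ∀ i → ρ (ρ i) ≡ i
  ρρ = Fin.opposite-involutive

  toℕ-ρ : ∀ i → toℕ (ρ i) ≡ k ℕ.∸ toℕ i
  toℕ-ρ i = ≡.trans (Fin.opposite-prop i) (≡.cong (ℕ._∸ suc (toℕ i)) N≡1+k)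

  toℕ-ρ-ℤ : ∀ i → + toℕ (ρ i) ≡ + k ℤ.- + toℕ i
  toℕ-ρ-ℤ i = ≡.trans (≡.cong +_ (toℕ-ρ i))
    (≡.sym (≡.trans (ℤ.m-n≡m⊖n k (toℕ i)) (ℤ.⊖-≥ (i≤k i))))

  -- Equality would give `i + j = k`; then `2i ≤ k` forces `i ≤ j` while `2j < k` forces `j < i`.
  -- This is what keeps the identity matrix from being doubled by folding.
  below≢ρ : ∀ (i j : Fin N) → 2 ℕ.* toℕ i ℕ.≤ k → 2 ℕ.* toℕ j ℕ.< k → i ≢ ρ j
  below≢ρ i j 2i≤k 2j<k i≡ρj = ℕ.<-irrefl ≡.refl (ℕ.<-≤-trans j<i i≤j)
    where
    i+j≡k : toℕ i ℕ.+ toℕ j ≡ k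
    i+j≡k = ≡.trans (≡.cong (ℕ._+ toℕ j) (≡.trans (≡.cong toℕ i≡ρj) (toℕ-ρ j))) (ℕ.m∸n+n≡m (i≤k j))

    i≤j : toℕ i ℕ.≤ toℕ j
    i≤j = ℕ.+-cancelˡ-≤ (toℕ i) _ _ (≡.subst₂ ℕ._≤_ (2*n≡n+n (toℕ i)) (≡.sym i+j≡k) 2i≤k)

    j<i : toℕ j ℕ.< toℕ i
    j<i = ℕ.+-cancelʳ-< (toℕ j) _ _ (≡.subst₂ ℕ._<_ (2*n≡n+n (toℕ j)) (≡.sym i+j≡k) 2j<k)

  -- `A⁺` and `A⁻` have different index types, so an index off the centre carries a representative
  -- in each, taken from its mirror image when it lies above. The centre has no representative for
  -- `A⁻`.
  data Position (i : Fin N) : Set where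
    below  : ∀ j⁺ j⁻ → 2 ℕ.* toℕ j⁺ ℕ.< k → ι⁺ j⁺ ≡ i → ι⁻ j⁻ ≡ i → Position i
    middle : ∀ j⁺ → ¬ 2 ℕ.* toℕ j⁺ ℕ.< k → ι⁺ j⁺ ≡ i → ρ i ≡ i → Position i
    above  : ∀ j⁺ j⁻ → 2 ℕ.* toℕ j⁺ ℕ.< k → ρ (ι⁺ j⁺) ≡ i → ρ (ι⁻ j⁻) ≡ i → Position i

  toℕ-index⁺ : ∀ ℓ (2ℓ≤k : 2 ℕ.* ℓ ℕ.≤ k) → toℕ (index⁺ ℓ 2ℓ≤k) ≡ ℓ
  toℕ-index⁺ ℓ 2ℓ≤k = Fin.toℕ-fromℕ< _

  toℕ-index⁻ : ∀ ℓ (2ℓ<k : 2 ℕ.* ℓ ℕ.< k) → toℕ (index⁻ ℓ 2ℓ<k) ≡ ℓ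
  toℕ-index⁻ ℓ 2ℓ<k = Fin.toℕ-fromℕ< _

  ι⁺-index⁺ : ∀ i 2i≤k → ι⁺ (index⁺ (toℕ i) 2i≤k) ≡ i
  ι⁺-index⁺ i 2i≤k = Fin.toℕ-injective (≡.trans (toℕ-ι⁺ _) (toℕ-index⁺ (toℕ i) 2i≤k))

  ι⁻-index⁻ : ∀ i 2i<k → ι⁻ (index⁻ (toℕ i) 2i<k) ≡ i
  ι⁻-index⁻ i 2i<k = Fin.toℕ-injective (≡.trans (toℕ-ι⁻ _) (toℕ-index⁻ (toℕ i) 2i<k))

  position : ∀ i → Position i
  position i with ℕ.<-cmp (2 ℕ.* toℕ i) k
  ... | tri< 2i<k _ _ = below (index⁺ (toℕ i) (ℕ.<⇒≤ 2i<k)) (index⁻ (toℕ i) 2i<k)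
    (≡.subst (λ n → 2 ℕ.* n ℕ.< k) (≡.sym (toℕ-index⁺ (toℕ i) (ℕ.<⇒≤ 2i<k))) 2i<k)
    (ι⁺-index⁺ i (ℕ.<⇒≤ 2i<k)) (ι⁻-index⁻ i 2i<k)
  ... | tri≈ 2i≮k 2i≡k _ = middle (index⁺ (toℕ i) (ℕ.≤-reflexive 2i≡k))
    (2i≮k ∘ ≡.subst (λ n → 2 ℕ.* n ℕ.< k) (toℕ-index⁺ (toℕ i) (ℕ.≤-reflexive 2i≡k)))
    (ι⁺-index⁺ i (ℕ.≤-reflexive 2i≡k))
    (Fin.toℕ-injective (≡.trans (toℕ-ρ i)
      (≡.trans (≡.cong (ℕ._∸ toℕ i) (≡.trans (≡.sym 2i≡k) (2*n≡n+n (toℕ i))))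
        (ℕ.m+n∸n≡m (toℕ i) (toℕ i)))))
  ... | tri> _ _ k<2i = above (index⁺ (toℕ (ρ i)) (ℕ.<⇒≤ 2ρi<k)) (index⁻ (toℕ (ρ i)) 2ρi<k)
    (≡.subst (λ n → 2 ℕ.* n ℕ.< k) (≡.sym (toℕ-index⁺ (toℕ (ρ i)) (ℕ.<⇒≤ 2ρi<k))) 2ρi<k)
    (≡.trans (≡.cong ρ (ι⁺-index⁺ (ρ i) (ℕ.<⇒≤ 2ρi<k))) (ρρ i))
    (≡.trans (≡.cong ρ (ι⁻-index⁻ (ρ i) 2ρi<k)) (ρρ i))
    where
    ρi+i≡k : toℕ (ρ i) ℕ.+ toℕ i ≡ k
    ρi+i≡k = ≡.trans (≡.cong (ℕ._+ toℕ i) (toℕ-ρ i)) (ℕ.m∸n+n≡m (i≤k i))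

    ρi<i : toℕ (ρ i) ℕ.< toℕ i
    ρi<i = ℕ.+-cancelʳ-< (toℕ i) _ _ (≡.subst₂ ℕ._<_ (≡.sym ρi+i≡k) (2*n≡n+n (toℕ i)) k<2i)

    2ρi<k : 2 ℕ.* toℕ (ρ i) ℕ.< k
    2ρi<k = ≡.subst₂ ℕ._<_ (≡.sym (2*n≡n+n (toℕ (ρ i)))) ρi+i≡k (ℕ.+-monoʳ-< (toℕ (ρ i)) ρi<i)

  -- The matrix `1 - A_k` and its symmetries

  M : Matrix N
  M i j = 1ᴹ i j - ω (+ toℕ j ℤ.- + toℕ i)

  ω-flip : ∀ {s t} → s ≡ ℤ.- t → ω s ≈ ω t
  ω-flip {t = t} ≡.refl = ω-even t

  M-symmetric : ∀ i j → M i j ≈ M j i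
  M-symmetric i j = +-cong (basis-sym i j) (-‿cong (ω-flip
    (ℤ-solve 2 (λ i j → j :- i ℤ:= :- (i :- j)) ≡.refl (+ toℕ i) (+ toℕ j))))
    

  basis-ρ : ∀ i j → basis (ρ i) j ≈ basis i (ρ j)
  basis-ρ i j = trans
    (reflexive (≡.cong (basis (ρ i)) (≡.sym (ρρ j))))
    (basis-injective {f = ρ} (λ {a} {b} eq → ≡.trans (≡.sym (ρρ a)) (≡.trans (≡.cong ρ eq) (ρρ b))) i (ρ j))

  -- The weights agree because `j - (k - i) = -((k - j) - i)` and `ω` is even.
  M-ρ : ∀ i j → M (ρ i) j ≈ M i (ρ j)
  M-ρ i j = +-cong (basis-ρ i j) (-‿cong (ω-flip (≡.trans
    (≡.cong (λ a → + toℕ j ℤ.- a) (toℕ-ρ-ℤ i))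
    (≡.trans
      (ℤ-solve 3 (λ i j k → j :- (k :- i) ℤ:= :- (k :- j :- i)) ≡.refl (+ toℕ i) (+ toℕ j) (+ k))
      (≡.cong (λ a → ℤ.- (a ℤ.- + toℕ i)) (≡.sym (toℕ-ρ-ℤ j)))))))
    

  -- The two folding maps

  if-yes : ∀ {a} {P : Set a} (P? : Dec P) → P → ∀ {x y : Carrier} → (if does P? then x else y) ≈ x
  if-yes P? p {x} {y} = reflexive (≡.cong (λ b → if b then x else y) (dec-true P? p))

  if-no : ∀ {a} {P : Set a} (P? : Dec P) → ¬ P → ∀ {x y : Carrier} → (if does P? then x else y) ≈ y
  if-no P? ¬p {x} {y} = reflexive (≡.cong (λ b → if b then x else y) (dec-false P? ¬p))

  -- The case split is the one in `A⁺`, so that folding matches its columns. At the centre both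
  -- summands would be the same coordinate, which is counted once.
  fold⁺ : Row N → Row p
  fold⁺ x j = if does (2 ℕ.* toℕ j ℕ.<? k) then x (ι⁺ j) + x (ρ (ι⁺ j)) else x (ι⁺ j)

  fold⁻ : Row N → Row m
  fold⁻ x j = x (ι⁻ j) - x (ρ (ι⁻ j))

  fold⁺-below : ∀ x j → 2 ℕ.* toℕ j ℕ.< k → fold⁺ x j ≈ x (ι⁺ j) + x (ρ (ι⁺ j))
  fold⁺-below x j 2j<k = if-yes (2 ℕ.* toℕ j ℕ.<? k) 2j<k

  fold⁺-middle : ∀ x j → ¬ 2 ℕ.* toℕ j ℕ.< k → fold⁺ x j ≈ x (ι⁺ j)
  fold⁺-middle x j 2j≮k = if-no (2 ℕ.* toℕ j ℕ.<? k) 2j≮k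

  by-cases : ∀ {a} {P : Set a} (j : Fin p) → (2 ℕ.* toℕ j ℕ.< k → P) → (¬ 2 ℕ.* toℕ j ℕ.< k → P) → P
  by-cases j f g with 2 ℕ.* toℕ j ℕ.<? k
  ... | yes 2j<k = f 2j<k
  ... | no 2j≮k  = g 2j≮k

  fold⁺-linear : LinearMap fold⁺
  fold⁺-linear j .cong {x} {y} x≋y = by-cases j
    (λ 2j<k → trans (fold⁺-below x j 2j<k) (trans (+-cong (x≋y _) (x≋y _)) (sym (fold⁺-below y j 2j<k))))
    (λ 2j≮k → trans (fold⁺-middle x j 2j≮k) (trans (x≋y _) (sym (fold⁺-middle y j 2j≮k))))
  fold⁺-linear j .linear a x y = by-cases j
    (λ 2j<k → begin
      fold⁺ (a · x ⊕ y) j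
        ≈⟨ fold⁺-below (a · x ⊕ y) j 2j<k ⟩
      (a * x (ι⁺ j) + y (ι⁺ j)) + (a * x (ρ (ι⁺ j)) + y (ρ (ι⁺ j)))
        ≈⟨ solve 5 (λ a x x′ y y′ → (a :* x :+ y) :+ (a :* x′ :+ y′) := a :* (x :+ x′) :+ (y :+ y′))
             refl a (x (ι⁺ j)) (x (ρ (ι⁺ j))) (y (ι⁺ j)) (y (ρ (ι⁺ j))) ⟩
      a * (x (ι⁺ j) + x (ρ (ι⁺ j))) + (y (ι⁺ j) + y (ρ (ι⁺ j)))
        ≈⟨ +-cong (*-congˡ (fold⁺-below x j 2j<k)) (fold⁺-below y j 2j<k) ⟨
      a * fold⁺ x j + fold⁺ y j ∎)
    (λ 2j≮k → begin
      fold⁺ (a · x ⊕ y) j       ≈⟨ fold⁺-middle (a · x ⊕ y) j 2j≮k ⟩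
      a * x (ι⁺ j) + y (ι⁺ j)   ≈⟨ +-cong (*-congˡ (fold⁺-middle x j 2j≮k)) (fold⁺-middle y j 2j≮k) ⟨
      a * fold⁺ x j + fold⁺ y j ∎)

  fold⁻-linear : LinearMap fold⁻
  fold⁻-linear j .cong x≋y = +-cong (x≋y _) (-‿cong (x≋y _))
  fold⁻-linear j .linear a x y = begin
    (a * x (ι⁻ j) + y (ι⁻ j)) - (a * x (ρ (ι⁻ j)) + y (ρ (ι⁻ j)))
      ≈⟨ +-congˡ (-1*x≈-x _) ⟨
    (a * x (ι⁻ j) + y (ι⁻ j)) + -1# * (a * x (ρ (ι⁻ j)) + y (ρ (ι⁻ j)))
      ≈⟨ solve 6 (λ s a x x′ y y′ → (a :* x :+ y) :+ s :* (a :* x′ :+ y′)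
                                 := a :* (x :+ s :* x′) :+ (y :+ s :* y′))
           refl -1# a (x (ι⁻ j)) (x (ρ (ι⁻ j))) (y (ι⁻ j)) (y (ρ (ι⁻ j))) ⟩
    a * (x (ι⁻ j) + -1# * x (ρ (ι⁻ j))) + (y (ι⁻ j) + -1# * y (ρ (ι⁻ j)))
      ≈⟨ +-cong (*-congˡ (+-congˡ (-1*x≈-x _))) (+-congˡ (-1*x≈-x _)) ⟩
    a * fold⁻ x j + fold⁻ y j ∎

  fold⁺-ρ : ∀ x → fold⁺ (x ∘ ρ) ≋ fold⁺ x
  fold⁺-ρ x j = by-cases j
    (λ 2j<k → begin
      fold⁺ (x ∘ ρ) j                     ≈⟨ fold⁺-below (x ∘ ρ) j 2j<k ⟩
      x (ρ (ι⁺ j)) + x (ρ (ρ (ι⁺ j)))     ≡⟨ ≡.cong (λ i → x (ρ (ι⁺ j)) + x i) (ρρ (ι⁺ j)) ⟩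
      x (ρ (ι⁺ j)) + x (ι⁺ j)             ≈⟨ +-comm _ _ ⟩
      x (ι⁺ j) + x (ρ (ι⁺ j))             ≈⟨ fold⁺-below x j 2j<k ⟨
      fold⁺ x j                           ∎)
    (λ 2j≮k → begin
      fold⁺ (x ∘ ρ) j ≈⟨ fold⁺-middle (x ∘ ρ) j 2j≮k ⟩
      x (ρ (ι⁺ j))    ≡⟨ ≡.cong x (ρ-middle 2j≮k (position (ι⁺ j))) ⟩
      x (ι⁺ j)        ≈⟨ fold⁺-middle x j 2j≮k ⟨
      fold⁺ x j       ∎)
    where
    2ι⁺j≤k : 2 ℕ.* toℕ (ι⁺ j) ℕ.≤ k
    2ι⁺j≤k = ≡.subst (λ n → 2 ℕ.* n ℕ.≤ k) (≡.sym (toℕ-ι⁺ j)) (2j≤k j)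

    -- An index of `A⁺` that is not strictly below `k/2` is the centre: lying below contradicts the
    -- hypothesis, and lying above contradicts `2j ≤ k`.
    ρ-middle : ¬ 2 ℕ.* toℕ j ℕ.< k → Position (ι⁺ j) → ρ (ι⁺ j) ≡ ι⁺ j
    ρ-middle 2j≮k (middle _ _ _ ρi≡i) = ρi≡i
    ρ-middle 2j≮k (below l _ 2l<k ι⁺l≡ι⁺j _) =
      contradiction (≡.subst (λ i → 2 ℕ.* toℕ i ℕ.< k) (Fin.inject≤-injective p≤N p≤N l j ι⁺l≡ι⁺j) 2l<k) 2j≮k
    ρ-middle 2j≮k (above l _ 2l<k ρι⁺l≡ι⁺j _) = contradiction (≡.sym ρι⁺l≡ι⁺j)
      (below≢ρ (ι⁺ j) (ι⁺ l) 2ι⁺j≤k (≡.subst (λ n → 2 ℕ.* n ℕ.< k) (≡.sym (toℕ-ι⁺ l)) 2l<k))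

  fold⁻-ρ : ∀ x → ∀ j → fold⁻ (x ∘ ρ) j ≈ - fold⁻ x j
  fold⁻-ρ x j = begin
    x (ρ (ι⁻ j)) - x (ρ (ρ (ι⁻ j))) ≡⟨ ≡.cong (λ i → x (ρ (ι⁻ j)) - x i) (ρρ (ι⁻ j)) ⟩
    x (ρ (ι⁻ j)) - x (ι⁻ j)         ≈⟨ ⁻¹-anti-homo‿- _ _ ⟨
    - fold⁻ x j                     ∎

  -- Folding rows of `M`, and the intertwining relations

  module _ (j : Fin p) where
    private
      2ι⁺j≤k : 2 ℕ.* toℕ (ι⁺ j) ℕ.≤ k
      2ι⁺j≤k = ≡.subst (λ n → 2 ℕ.* n ℕ.≤ k) (≡.sym (toℕ-ι⁺ j)) (2j≤k j)

      basis-ι⁺ : ∀ l → basis (ι⁺ j) (ι⁺ l) ≈ basis j l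
      basis-ι⁺ = basis-injective {f = ι⁺} (Fin.inject≤-injective p≤N p≤N _ _) j

      basis-ρι⁺ : ∀ {l} → 2 ℕ.* toℕ l ℕ.< k → basis (ι⁺ j) (ρ (ι⁺ l)) ≈ 0#
      basis-ρι⁺ {l} 2l<k =
        basis-≢ (below≢ρ (ι⁺ j) (ι⁺ l) 2ι⁺j≤k (≡.subst (λ n → 2 ℕ.* n ℕ.< k) (≡.sym (toℕ-ι⁺ l)) 2l<k))

      ω-ι⁺ : ∀ l → ω (+ toℕ (ι⁺ l) ℤ.- + toℕ (ι⁺ j)) ≡ ω (+ toℕ l ℤ.- + toℕ j)
      ω-ι⁺ l = ≡.cong₂ (λ a b → ω (+ a ℤ.- + b)) (toℕ-ι⁺ l) (toℕ-ι⁺ j)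

      ω-ρι⁺ : ∀ l → ω (+ toℕ (ρ (ι⁺ l)) ℤ.- + toℕ (ι⁺ j)) ≡ ω (+ k ℤ.- + toℕ l ℤ.- + toℕ j)
      ω-ρι⁺ l = ≡.cong₂ (λ a b → ω (a ℤ.- + b))
        (≡.trans (toℕ-ρ-ℤ (ι⁺ l)) (≡.cong (λ a → + k ℤ.- + a) (toℕ-ι⁺ l))) (toℕ-ι⁺ j)

    fold⁺-basis : fold⁺ (basis (ι⁺ j)) ≋ basis j
    fold⁺-basis l = by-cases l
      (λ 2l<k → begin
        fold⁺ (basis (ι⁺ j)) l
          ≈⟨ fold⁺-below (basis (ι⁺ j)) l 2l<k ⟩
        basis (ι⁺ j) (ι⁺ l) + basis (ι⁺ j) (ρ (ι⁺ l))
          ≈⟨ +-cong (basis-ι⁺ l) (basis-ρι⁺ 2l<k) ⟩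
        basis j l + 0#
          ≈⟨ +-identityʳ _ ⟩
        basis j l ∎)
      (λ 2l≮k → trans (fold⁺-middle (basis (ι⁺ j)) l 2l≮k) (basis-ι⁺ l))

    -- The mirrored column contributes only the weight `ω (k - l - j)`, because its identity entry
    -- is 0 by `below≢ρ`.
    fold⁺-M : fold⁺ (M (ι⁺ j)) ≋ (1- A⁺ k) j
    fold⁺-M l = by-cases l
      (λ 2l<k → begin
        fold⁺ (M (ι⁺ j)) l
          ≈⟨ fold⁺-below (M (ι⁺ j)) l 2l<k ⟩
        M (ι⁺ j) (ι⁺ l) + M (ι⁺ j) (ρ (ι⁺ l))
          ≈⟨ +-cong (+-cong (basis-ι⁺ l) (-‿cong (reflexive (ω-ι⁺ l))))
                    (trans (+-cong (basis-ρι⁺ 2l<k) (-‿cong (reflexive (ω-ρι⁺ l)))) (+-identityˡ _)) ⟩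
        basis j l - ω (+ toℕ l ℤ.- + toℕ j) - ω (+ k ℤ.- + toℕ l ℤ.- + toℕ j)
          ≈⟨ trans (+-assoc _ _ _) (+-congˡ (-‿+-comm _ _)) ⟩
        basis j l - (ω (+ toℕ l ℤ.- + toℕ j) + ω (+ k ℤ.- + toℕ l ℤ.- + toℕ j))
          ≈⟨ +-congˡ (-‿cong (if-yes (2 ℕ.* toℕ l ℕ.<? k) 2l<k)) ⟨
        (1- A⁺ k) j l ∎)
      (λ 2l≮k → begin
        fold⁺ (M (ι⁺ j)) l                  ≈⟨ fold⁺-middle (M (ι⁺ j)) l 2l≮k ⟩
        M (ι⁺ j) (ι⁺ l)                     ≈⟨ +-cong (basis-ι⁺ l) (-‿cong (reflexive (ω-ι⁺ l))) ⟩
        basis j l - ω (+ toℕ l ℤ.- + toℕ j) ≈⟨ +-congˡ (-‿cong (if-no (2 ℕ.* toℕ l ℕ.<? k) 2l≮k)) ⟨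
        (1- A⁺ k) j l                       ∎)

  module _ (j : Fin m) where
    private
      basis-ι⁻ : ∀ l → basis (ι⁻ j) (ι⁻ l) ≈ basis j l
      basis-ι⁻ = basis-injective {f = ι⁻} (Fin.inject≤-injective m≤N m≤N _ _) j

      basis-ρι⁻ : ∀ l → basis (ι⁻ j) (ρ (ι⁻ l)) ≈ 0#
      basis-ρι⁻ l = basis-≢ (below≢ρ (ι⁻ j) (ι⁻ l) (ℕ.<⇒≤ (bound j)) (bound l))
        where
        bound : ∀ l → 2 ℕ.* toℕ (ι⁻ l) ℕ.< k
        bound l = ≡.subst (λ n → 2 ℕ.* n ℕ.< k) (≡.sym (toℕ-ι⁻ l)) (2j<k l)

      ω-ι⁻ : ∀ l → ω (+ toℕ (ι⁻ l) ℤ.- + toℕ (ι⁻ j)) ≡ ω (+ toℕ l ℤ.- + toℕ j)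
      ω-ι⁻ l = ≡.cong₂ (λ a b → ω (+ a ℤ.- + b)) (toℕ-ι⁻ l) (toℕ-ι⁻ j)

      ω-ρι⁻ : ∀ l → ω (+ toℕ (ρ (ι⁻ l)) ℤ.- + toℕ (ι⁻ j)) ≡ ω (+ k ℤ.- + toℕ l ℤ.- + toℕ j)
      ω-ρι⁻ l = ≡.cong₂ (λ a b → ω (a ℤ.- + b))
        (≡.trans (toℕ-ρ-ℤ (ι⁻ l)) (≡.cong (λ a → + k ℤ.- + a) (toℕ-ι⁻ l))) (toℕ-ι⁻ j)

    fold⁻-basis : fold⁻ (basis (ι⁻ j)) ≋ basis j
    fold⁻-basis l = begin
      basis (ι⁻ j) (ι⁻ l) - basis (ι⁻ j) (ρ (ι⁻ l)) ≈⟨ +-cong (basis-ι⁻ l) (-‿cong (basis-ρι⁻ l)) ⟩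
      basis j l - 0#                                ≈⟨ +-congˡ -0#≈0# ⟩
      basis j l + 0#                                ≈⟨ +-identityʳ _ ⟩
      basis j l                                     ∎

    fold⁻-M : fold⁻ (M (ι⁻ j)) ≋ (1- A⁻ k) j
    fold⁻-M l = begin
      M (ι⁻ j) (ι⁻ l) - M (ι⁻ j) (ρ (ι⁻ l))
        ≈⟨ +-cong (+-cong (basis-ι⁻ l) (-‿cong (reflexive (ω-ι⁻ l))))
             (-‿cong (trans (+-cong (basis-ρι⁻ l) (-‿cong (reflexive (ω-ρι⁻ l)))) (+-identityˡ _))) ⟩
      basis j l - w - - w′   ≈⟨ +-assoc _ _ _ ⟩
      basis j l + (- w - - w′) ≈⟨ +-congˡ (-‿+-comm w (- w′)) ⟩
      basis j l - (w - w′)   ∎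
      where
      w w′ : Carrier
      w  = ω (+ toℕ l ℤ.- + toℕ j)
      w′ = ω (+ k ℤ.- + toℕ l ℤ.- + toℕ j)

  -- By linearity `x` may be a unit vector. Up to the centre, `fold⁺-M` applies directly; beyond it,
  -- `M-ρ` moves the reflection onto columns, where `fold⁺` absorbs it.
  fold⁺-intertwines : ∀ x → fold⁺ (x ⟨*⟩ M) ≋ (fold⁺ x ⟨*⟩ (1- A⁺ k))
  fold⁺-intertwines x l = linear-ext
    (LinearMap-∘ (fold⁺-linear l) (⟨*⟩-linear M))
    (LinearMap-∘ (⟨*⟩-linear (1- A⁺ k) l) fold⁺-linear)
    (λ i → trans (fold⁺-linear l .cong (basis-⟨*⟩ i M)) (on-basis i (position i)))
    x
    where
    lower : ∀ j → fold⁺ (M (ι⁺ j)) l ≈ (fold⁺ (basis (ι⁺ j)) ⟨*⟩ (1- A⁺ k)) l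
    lower j = begin
      fold⁺ (M (ι⁺ j)) l                         ≈⟨ fold⁺-M j l ⟩
      (1- A⁺ k) j l                              ≈⟨ basis-⟨*⟩ j (1- A⁺ k) l ⟨
      (basis j ⟨*⟩ (1- A⁺ k)) l                  ≈⟨ ⟨*⟩-linear (1- A⁺ k) l .cong (fold⁺-basis j) ⟨
      (fold⁺ (basis (ι⁺ j)) ⟨*⟩ (1- A⁺ k)) l     ∎

    on-basis : ∀ i → Position i → fold⁺ (M i) l ≈ (fold⁺ (basis i) ⟨*⟩ (1- A⁺ k)) l
    on-basis _ (below j _ _ ≡.refl _)  = lower j
    on-basis _ (middle j _ ≡.refl _)   = lower j
    on-basis _ (above j _ _ ≡.refl _)  = begin
      fold⁺ (M (ρ (ι⁺ j))) l
        ≈⟨ fold⁺-linear l .cong (M-ρ (ι⁺ j)) ⟩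
      fold⁺ (M (ι⁺ j) ∘ ρ) l
        ≈⟨ fold⁺-ρ (M (ι⁺ j)) l ⟩
      fold⁺ (M (ι⁺ j)) l
        ≈⟨ lower j ⟩
      (fold⁺ (basis (ι⁺ j)) ⟨*⟩ (1- A⁺ k)) l
        ≈⟨ ⟨*⟩-linear (1- A⁺ k) l .cong (λ a → trans
             (fold⁺-linear a .cong (basis-ρ (ι⁺ j))) (fold⁺-ρ (basis (ι⁺ j)) a)) ⟨
      (fold⁺ (basis (ρ (ι⁺ j))) ⟨*⟩ (1- A⁺ k)) l ∎

  fold⁻-intertwines : ∀ x → fold⁻ (x ⟨*⟩ M) ≋ (fold⁻ x ⟨*⟩ (1- A⁻ k))
  fold⁻-intertwines x l = linear-ext
    (LinearMap-∘ (fold⁻-linear l) (⟨*⟩-linear M))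
    (LinearMap-∘ (⟨*⟩-linear (1- A⁻ k) l) fold⁻-linear)
    (λ i → trans (fold⁻-linear l .cong (basis-⟨*⟩ i M)) (on-basis i (position i)))
    x
    where
    T-linear = ⟨*⟩-linear (1- A⁻ k) l

    lower : ∀ j → fold⁻ (M (ι⁻ j)) l ≈ (fold⁻ (basis (ι⁻ j)) ⟨*⟩ (1- A⁻ k)) l
    lower j = begin
      fold⁻ (M (ι⁻ j)) l                         ≈⟨ fold⁻-M j l ⟩
      (1- A⁻ k) j l                              ≈⟨ basis-⟨*⟩ j (1- A⁻ k) l ⟨
      (basis j ⟨*⟩ (1- A⁻ k)) l                  ≈⟨ T-linear .cong (fold⁻-basis j) ⟨
      (fold⁻ (basis (ι⁻ j)) ⟨*⟩ (1- A⁻ k)) l     ∎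

    invariant : ∀ {x} → (∀ a → x a ≈ x (ρ a)) → fold⁻ x ≋ 0ʳ
    invariant x≈xρ a = trans (+-congʳ (x≈xρ (ι⁻ a))) (-‿inverseʳ _)

    on-basis : ∀ i → Position i → fold⁻ (M i) l ≈ (fold⁻ (basis i) ⟨*⟩ (1- A⁻ k)) l
    on-basis _ (below _ j _ _ ≡.refl)  = lower j
    -- Both the central row of `M` and the central unit vector are invariant under reflection, so
    -- both sides have antisymmetric part 0.
    on-basis i (middle _ _ _ ρi≡i) = trans
      (invariant (λ a → trans (reflexive (≡.cong (λ b → M b a) (≡.sym ρi≡i))) (M-ρ i a)) l)
      (sym (zero-homo T-linear
        (invariant λ a → trans (reflexive (≡.cong (λ b → basis b a) (≡.sym ρi≡i))) (basis-ρ i a))))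
    on-basis _ (above _ j _ _ ≡.refl)  = begin
      fold⁻ (M (ρ (ι⁻ j))) l
        ≈⟨ fold⁻-linear l .cong (M-ρ (ι⁻ j)) ⟩
      fold⁻ (M (ι⁻ j) ∘ ρ) l
        ≈⟨ fold⁻-ρ (M (ι⁻ j)) l ⟩
      - fold⁻ (M (ι⁻ j)) l
        ≈⟨ -‿cong (lower j) ⟩
      - (fold⁻ (basis (ι⁻ j)) ⟨*⟩ (1- A⁻ k)) l
        ≈⟨ negate (fold⁻ (basis (ι⁻ j))) ⟨
      ((λ a → - fold⁻ (basis (ι⁻ j)) a) ⟨*⟩ (1- A⁻ k)) l
        ≈⟨ T-linear .cong (λ a → trans
             (fold⁻-linear a .cong (basis-ρ (ι⁻ j))) (fold⁻-ρ (basis (ι⁻ j)) a)) ⟨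
      (fold⁻ (basis (ρ (ι⁻ j))) ⟨*⟩ (1- A⁻ k)) l ∎
      where
      negate : ∀ y → ((λ a → - y a) ⟨*⟩ (1- A⁻ k)) l ≈ - (y ⟨*⟩ (1- A⁻ k)) l
      negate y = begin
        ((λ a → - y a) ⟨*⟩ (1- A⁻ k)) l
          ≈⟨ T-linear .cong (λ a → trans (+-identityʳ _) (-1*x≈-x (y a))) ⟨
        ((-1# · y ⊕ 0ʳ) ⟨*⟩ (1- A⁻ k)) l
          ≈⟨ T-linear .linear -1# y 0ʳ ⟩
        -1# * (y ⟨*⟩ (1- A⁻ k)) l + (0ʳ ⟨*⟩ (1- A⁻ k)) l
          ≈⟨ trans (+-cong (-1*x≈-x _) (zero-homo T-linear λ _ → refl)) (+-identityʳ _) ⟩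
        - (y ⟨*⟩ (1- A⁻ k)) l ∎

-- Symmetry speaks of weights on `S` only. It is applied at whichever of `s` and `-s` lies in `S`;
-- if neither does, both weights vanish.
symmetric⇒even : ∀ {c e} (K : Field c e) (W : WeightedSet K) → Symmetric K W →
  let open Field K; open WeightedSet W in ∀ s → ω (ℤ.- s) ≈ ω s
symmetric⇒even K W (_ , ω-sym) s with s ∈? S | (ℤ.- s) ∈? S
  where open WeightedSet W
... | yes s∈S | _        = ω-sym s∈S
... | no  s∉S | yes -s∈S = Field.trans K (Field.sym K (ω-sym -s∈S))
  (Field.reflexive K (≡.cong (WeightedSet.ω W) (ℤ.neg-involutive s)))
... | no  s∉S | no  -s∉S = Field.trans K (ω-∉ -s∉S) (Field.sym K (ω-∉ s∉S))
  where open WeightedSet W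

-- The factorization of the determinant

module Factorization {c e} (K : Field c e) (½ : Field.Carrier K)
  (½*2≈1 : Field._≈_ K (Field._*_ K ½ (Field._+_ K (Field.1# K) (Field.1# K))) (Field.1# K))
  (W : WeightedSet K)
  (ω-even : ∀ s → Field._≈_ K (WeightedSet.ω W (ℤ.- s)) (WeightedSet.ω W s))
  (k : ℕ) where
  open Field K
  open Matrices K
  open Transfer K W
  open Determinants commutativeRing
  open FieldDeterminants K
  open Linear
  open import Algebra.Properties.Ring ring using (-1*x≈-x)
  open import Algebra.Properties.AbelianGroup +-abelianGroup using (⁻¹-anti-homo‿-)
  open import Algebra.Solver.Ring.NaturalCoefficients.Default commutativeSemiring
    using (solve; _:+_; _:*_; _:=_)
  open import Relation.Binary.Reasoning.Setoid setoid

  p+m≡1+k : suc ⌊ k /2⌋ ℕ.+ ⌈ k /2⌉ ≡ suc k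
  p+m≡1+k = ≡.cong suc (ℕ.⌊n/2⌋+⌈n/2⌉≡n k)

  open Folding K W ω-even k p+m≡1+k

  fold : Row (p ℕ.+ m) → Row (p ℕ.+ m)
  fold x = fold⁺ x F.++ fold⁻ x

  fold-linear : LinearMap fold
  fold-linear j .cong x≋y with splitAt p j
  ... | inj₁ l = fold⁺-linear l .cong x≋y
  ... | inj₂ l = fold⁻-linear l .cong x≋y
  fold-linear j .linear a x y with splitAt p j
  ... | inj₁ l = fold⁺-linear l .linear a x y
  ... | inj₂ l = fold⁻-linear l .linear a x y

  fold-↑ˡ : ∀ x j → fold x (j ↑ˡ m) ≈ fold⁺ x j
  fold-↑ˡ x j = reflexive (≡.cong [ fold⁺ x , fold⁻ x ] (Fin.splitAt-↑ˡ p j m))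

  fold-↑ʳ : ∀ x j → fold x (p ↑ʳ j) ≈ fold⁻ x j
  fold-↑ʳ x j = reflexive (≡.cong [ fold⁺ x , fold⁻ x ] (Fin.splitAt-↑ʳ p m j))

  -- A coordinate below the centre is half the sum of its symmetric and antisymmetric parts, and its
  -- mirror image is half their difference.
  unfold : Row (p ℕ.+ m) → Row (p ℕ.+ m)
  unfold y i with position i
  ... | below j⁺ j⁻ _ _ _ = ½ * (y (j⁺ ↑ˡ m) + y (p ↑ʳ j⁻))
  ... | middle j⁺ _ _ _   = y (j⁺ ↑ˡ m)
  ... | above j⁺ j⁻ _ _ _ = ½ * (y (j⁺ ↑ˡ m) - y (p ↑ʳ j⁻))

  unfold-linear : LinearMap unfold
  unfold-linear i .cong x≋y with position i
  ... | below _ _ _ _ _  = *-congˡ (+-cong (x≋y _) (x≋y _))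
  ... | middle _ _ _ _   = x≋y _
  ... | above _ _ _ _ _  = *-congˡ (+-cong (x≋y _) (-‿cong (x≋y _)))
  unfold-linear i .linear a x y with position i
  ... | below j⁺ j⁻ _ _ _ =
    solve 6 (λ h a x x′ y y′ → h :* ((a :* x :+ y) :+ (a :* x′ :+ y′))
                            := a :* (h :* (x :+ x′)) :+ h :* (y :+ y′))
      refl ½ a (x (j⁺ ↑ˡ m)) (x (p ↑ʳ j⁻)) (y (j⁺ ↑ˡ m)) (y (p ↑ʳ j⁻))
  ... | middle _ _ _ _    = refl
  ... | above j⁺ j⁻ _ _ _ = begin
    ½ * ((a * x₁ + y₁) - (a * x₂ + y₂))
      ≈⟨ *-congˡ (+-congˡ (-1*x≈-x _)) ⟨
    ½ * ((a * x₁ + y₁) + -1# * (a * x₂ + y₂))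
      ≈⟨ solve 7 (λ h s a x x′ y y′ → h :* ((a :* x :+ y) :+ s :* (a :* x′ :+ y′))
                                 := a :* (h :* (x :+ s :* x′)) :+ h :* (y :+ s :* y′))
           refl ½ -1# a x₁ x₂ y₁ y₂ ⟩
    a * (½ * (x₁ + -1# * x₂)) + ½ * (y₁ + -1# * y₂)
      ≈⟨ +-cong (*-congˡ (*-congˡ (+-congˡ (-1*x≈-x _)))) (*-congˡ (+-congˡ (-1*x≈-x _))) ⟩
    a * (½ * (x₁ - x₂)) + ½ * (y₁ - y₂) ∎
    where
    x₁ = x (j⁺ ↑ˡ m)
    x₂ = x (p ↑ʳ j⁻)
    y₁ = y (j⁺ ↑ˡ m)
    y₂ = y (p ↑ʳ j⁻)

  ½*[x+x]≈x : ∀ x → ½ * (x + x) ≈ x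
  ½*[x+x]≈x x = begin
    ½ * (x + x)             ≈⟨ *-congˡ (+-cong (*-identityˡ x) (*-identityˡ x)) ⟨
    ½ * (1# * x + 1# * x)   ≈⟨ *-congˡ (distribʳ x 1# 1#) ⟨
    ½ * ((1# + 1#) * x)     ≈⟨ *-assoc _ _ _ ⟨
    (½ * (1# + 1#)) * x     ≈⟨ *-congʳ ½*2≈1 ⟩
    1# * x                  ≈⟨ *-identityˡ x ⟩
    x                       ∎

  unfold-fold : ∀ x → unfold (fold x) ≋ x
  unfold-fold x i with position i
  ... | below j⁺ j⁻ 2j<k ι⁺j≡i ι⁻j≡i = trans (*-congˡ (begin
    fold x (j⁺ ↑ˡ m) + fold x (p ↑ʳ j⁻)
      ≈⟨ +-cong (trans (fold-↑ˡ x j⁺) (fold⁺-below x j⁺ 2j<k)) (fold-↑ʳ x j⁻) ⟩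
    (x (ι⁺ j⁺) + x (ρ (ι⁺ j⁺))) + (x (ι⁻ j⁻) - x (ρ (ι⁻ j⁻)))
      ≡⟨ ≡.cong₂ (λ a b → (x a + x (ρ a)) + (x b - x (ρ b))) ι⁺j≡i ι⁻j≡i ⟩
    (x i + x (ρ i)) + (x i - x (ρ i))
      ≈⟨ solve 3 (λ a b c → (a :+ b) :+ (a :+ c) := (a :+ a) :+ (b :+ c))
           refl (x i) (x (ρ i)) (- x (ρ i)) ⟩
    (x i + x i) + (x (ρ i) - x (ρ i))
      ≈⟨ trans (+-congˡ (-‿inverseʳ _)) (+-identityʳ _) ⟩
    x i + x i ∎)) (½*[x+x]≈x (x i))
  ... | middle j⁺ 2j≮k ι⁺j≡i _ = begin
    fold x (j⁺ ↑ˡ m) ≈⟨ fold-↑ˡ x j⁺ ⟩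
    fold⁺ x j⁺       ≈⟨ fold⁺-middle x j⁺ 2j≮k ⟩
    x (ι⁺ j⁺)        ≡⟨ ≡.cong x ι⁺j≡i ⟩
    x i              ∎
  ... | above j⁺ j⁻ 2j<k ρι⁺j≡i ρι⁻j≡i = trans (*-congˡ (begin
    fold x (j⁺ ↑ˡ m) - fold x (p ↑ʳ j⁻)
      ≈⟨ +-cong (trans (fold-↑ˡ x j⁺) (fold⁺-below x j⁺ 2j<k)) (-‿cong (fold-↑ʳ x j⁻)) ⟩
    (x (ι⁺ j⁺) + x (ρ (ι⁺ j⁺))) - (x (ι⁻ j⁻) - x (ρ (ι⁻ j⁻)))
      ≈⟨ +-congˡ (⁻¹-anti-homo‿- _ _) ⟩
    (x (ι⁺ j⁺) + x (ρ (ι⁺ j⁺))) + (x (ρ (ι⁻ j⁻)) - x (ι⁻ j⁻))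
      ≡⟨ ≡.cong₂ (λ a b → (x a + x (ρ (ι⁺ j⁺))) + (x (ρ (ι⁻ j⁻)) - x b))
           (≡.trans (≡.sym (ρρ _)) (≡.cong ρ ρι⁺j≡i)) (≡.trans (≡.sym (ρρ _)) (≡.cong ρ ρι⁻j≡i)) ⟩
    (x (ρ i) + x (ρ (ι⁺ j⁺))) + (x (ρ (ι⁻ j⁻)) - x (ρ i))
      ≡⟨ ≡.cong₂ (λ a b → (x (ρ i) + x a) + (x b - x (ρ i))) ρι⁺j≡i ρι⁻j≡i ⟩
    (x (ρ i) + x i) + (x i - x (ρ i))
      ≈⟨ solve 3 (λ a b c → (b :+ a) :+ (a :+ c) := (a :+ a) :+ (b :+ c))
           refl (x i) (x (ρ i)) (- x (ρ i)) ⟩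
    (x i + x i) + (x (ρ i) - x (ρ i))
      ≈⟨ trans (+-congˡ (-‿inverseʳ _)) (+-identityʳ _) ⟩
    x i + x i ∎)) (½*[x+x]≈x (x i))

  -- Right multiplication by the block-diagonal matrix with blocks `1- A⁺ k` and `1- A⁻ k`.
  T : Row (p ℕ.+ m) → Row (p ℕ.+ m)
  T y = (y ∘ (_↑ˡ m) ⟨*⟩ (1- A⁺ k)) F.++ (y ∘ (p ↑ʳ_) ⟨*⟩ (1- A⁻ k))

  T-linear : LinearMap T
  T-linear j .cong x≋y with splitAt p j
  ... | inj₁ l = ⟨*⟩-linear (1- A⁺ k) l .cong (λ i → x≋y (i ↑ˡ m))
  ... | inj₂ l = ⟨*⟩-linear (1- A⁻ k) l .cong (λ i → x≋y (p ↑ʳ i))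
  T-linear j .linear a x y with splitAt p j
  ... | inj₁ l = ⟨*⟩-linear (1- A⁺ k) l .linear a (x ∘ (_↑ˡ m)) (y ∘ (_↑ˡ m))
  ... | inj₂ l = ⟨*⟩-linear (1- A⁻ k) l .linear a (x ∘ (p ↑ʳ_)) (y ∘ (p ↑ʳ_))

  fold-intertwines : ∀ x → fold (x ⟨*⟩ M) ≋ T (fold x)
  fold-intertwines x j with splitAt p j
  ... | inj₁ l = trans (fold⁺-intertwines x l)
    (⟨*⟩-linear (1- A⁺ k) l .cong λ i → sym (fold-↑ˡ x i))
  ... | inj₂ l = trans (fold⁻-intertwines x l)
    (⟨*⟩-linear (1- A⁻ k) l .cong λ i → sym (fold-↑ʳ x i))

  basis-↑ˡ-↑ʳ : ∀ i j → basis {p ℕ.+ m} (i ↑ˡ m) (p ↑ʳ j) ≈ 0#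
  basis-↑ˡ-↑ʳ i j = basis-≢ (↑ˡ≢↑ʳ i j)
    where
    ↑ˡ≢↑ʳ : ∀ (i : Fin p) (j : Fin m) → i ↑ˡ m ≢ p ↑ʳ j
    ↑ˡ≢↑ʳ i j eq with () ← ≡.trans (≡.sym (Fin.splitAt-↑ˡ p i m))
      (≡.trans (≡.cong (splitAt p) eq) (Fin.splitAt-↑ʳ p m j))

  T-basis-↑ˡ : ∀ i → T (basis (i ↑ˡ m)) ≋ padʳ ((1- A⁺ k) i)
  T-basis-↑ˡ i j with splitAt p j
  ... | inj₁ l = trans
    (⟨*⟩-linear (1- A⁺ k) l .cong (basis-injective {f = _↑ˡ m} (Fin.↑ˡ-injective m _ _) i))
    (basis-⟨*⟩ i (1- A⁺ k) l)
  ... | inj₂ l = zero-homo (⟨*⟩-linear (1- A⁻ k) l) (basis-↑ˡ-↑ʳ i)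

  T-basis-↑ʳ : ∀ i → T (basis (p ↑ʳ i)) ≋ padˡ {p} ((1- A⁻ k) i)
  T-basis-↑ʳ i j with splitAt p j
  ... | inj₁ l = zero-homo (⟨*⟩-linear (1- A⁺ k) l)
    (λ a → trans (basis-sym (p ↑ʳ i) (a ↑ˡ m)) (basis-↑ˡ-↑ʳ a i))
  ... | inj₂ l = trans
    (⟨*⟩-linear (1- A⁻ k) l .cong (basis-injective {f = p ↑ʳ_} (Fin.↑ʳ-injective p _ _) i))
    (basis-⟨*⟩ i (1- A⁻ k) l)

  detʳ-T : detʳ (tabulate (T ∘ basis)) ≈ F⁺ (suc k) * F⁻ (suc k)
  detʳ-T = begin
    detʳ (tabulate (T ∘ basis))
      ≡⟨ ≡.cong detʳ (tabulate-split p (T ∘ basis)) ⟩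
    detʳ (tabulate (T ∘ basis ∘ (_↑ˡ m)) Vec.++ tabulate (T ∘ basis ∘ (p ↑ʳ_)))
      ≈⟨ detʳ-multilinear .Multilinear.rows-cong (tabulate-++-cong T-basis-↑ˡ T-basis-↑ʳ) ⟩
    detʳ (tabulate (padʳ {p} {m} ∘ (1- A⁺ k)) Vec.++ tabulate (padˡ ∘ (1- A⁻ k)))
      ≈⟨ detʳ-block-diagonal (1- A⁺ k) (1- A⁻ k) ⟩
    detʳ (tabulate (1- A⁺ k)) * detʳ (tabulate (1- A⁻ k))
      ≈⟨ *-cong (det≈detʳ (1- A⁺ k)) (det≈detʳ (1- A⁻ k)) ⟨
    F⁺ (suc k) * F⁻ (suc k) ∎
    where
    tabulate-split : ∀ {a} {A : Set a} p {m} (f : Fin (p ℕ.+ m) → A) →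
      tabulate f ≡ tabulate (f ∘ (_↑ˡ m)) Vec.++ tabulate (f ∘ (p ↑ʳ_))
    tabulate-split zero    f = ≡.refl
    tabulate-split (suc p) f = ≡.cong (f zero ∷_) (tabulate-split p (f ∘ suc))

  -- Taking determinants in `fold-intertwines` gives `det M * δ = δ * det T`. The factor `δ` is
  -- cancelled by `δ′`, because `unfold` undoes `fold`.
  detʳ-M : detʳ (tabulate M) ≈ F⁺ (suc k) * F⁻ (suc k)
  detʳ-M = begin
    detʳ (tabulate M)
      ≈⟨ trans (*-congˡ δδ′≈1) (*-identityʳ _) ⟨
    detʳ (tabulate M) * (δ * δ′)
      ≈⟨ *-assoc _ _ _ ⟨
    detʳ (tabulate M) * δ * δ′
      ≈⟨ *-congʳ (detʳ-map fold-linear M) ⟨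
    detʳ (tabulate (fold ∘ M)) * δ′
      ≈⟨ *-congʳ (detʳ-cong λ i j → trans
           (fold-linear j .cong λ l → sym (basis-⟨*⟩ i M l)) (fold-intertwines (basis i) j)) ⟩
    detʳ (tabulate (T ∘ fold ∘ basis)) * δ′
      ≈⟨ *-congʳ (detʳ-map T-linear (fold ∘ basis)) ⟩
    δ * detʳ (tabulate (T ∘ basis)) * δ′
      ≈⟨ solve 3 (λ d t d′ → d :* t :* d′ := d :* d′ :* t) refl δ _ δ′ ⟩
    δ * δ′ * detʳ (tabulate (T ∘ basis))
      ≈⟨ trans (*-congʳ δδ′≈1) (*-identityˡ _) ⟩
    detʳ (tabulate (T ∘ basis))
      ≈⟨ detʳ-T ⟩
    F⁺ (suc k) * F⁻ (suc k) ∎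
    where
    δ δ′ : Carrier
    δ  = detʳ (tabulate (fold ∘ basis))
    δ′ = detʳ (tabulate (unfold ∘ basis))

    δδ′≈1 : δ * δ′ ≈ 1#
    δδ′≈1 = begin
      δ * δ′                                      ≈⟨ detʳ-map unfold-linear (fold ∘ basis) ⟨
      detʳ (tabulate (unfold ∘ fold ∘ basis))     ≈⟨ detʳ-cong (unfold-fold ∘ basis) ⟩
      detʳ {p ℕ.+ m} (tabulate basis)                       ≈⟨ detʳ-1 (p ℕ.+ m) ⟩
      1#                                          ∎

  F-factorizes : F (suc k) ≈ F⁺ (suc k) * F⁻ (suc k)
  F-factorizes = trans (resize p+m≡1+k) detʳ-M
    where
    -- The size `p ℕ.+ m` does not reduce to `suc k`; with a variable `N` the equation can be
    -- matched against `refl`, where `Folding.M` becomes `1- A k`.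
    resize : ∀ {N} (N≡1+k : N ≡ suc k) →
             F (suc k) ≈ detʳ (tabulate (Folding.M K W ω-even k N≡1+k))
    resize ≡.refl = det≈detʳ (1- A k)

-- The inverse matrix and its folded first row

module Inverse {c e} (K : Field c e) (W : WeightedSet K)
  (ω-even : ∀ s → Field._≈_ K (WeightedSet.ω W (ℤ.- s)) (WeightedSet.ω W s))
  (k′ : ℕ) (F≉0 : ¬ Field._≈_ K (Transfer.F K W (suc (suc k′))) (Field.0# K)) where
  open Field K
  open Matrices K
  open Transfer K W
  open Determinants commutativeRing
  open FieldDeterminants K
  open Linear
  open import Algebra.Properties.Semiring.Sum semiring using (sum; sum-cong-≋; *-distribʳ-sum)
  open import Relation.Binary.Reasoning.Setoid setoid
  -- With `refl` as size equation `M` is definitionally the matrix `1- A k`. A successor here makes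
  -- `⌈ k /2⌉` a successor too, so `A⁻` has an index 0 and `e_0` exists on both sides.
  open Folding K W ω-even (suc k′) ≡.refl

  k : ℕ
  k = suc k′

  d⁻¹ : Carrier
  d⁻¹ = F (suc k) ⁻¹[ F≉0 ]

  E : Matrix (suc k)
  E i j = adjugate M i j * d⁻¹

  M*E≈1 : (M *ᴹ E) ≈ᴹ 1ᴹ
  M*E≈1 i j = begin
    sum (λ l → M i l * (adjugate M l j * d⁻¹))
      ≈⟨ sum-cong-≋ (λ l → *-assoc (M i l) (adjugate M l j) d⁻¹) ⟨
    sum (λ l → M i l * adjugate M l j * d⁻¹)
      ≈⟨ *-distribʳ-sum d⁻¹ (λ l → M i l * adjugate M l j) ⟨
    (M i ⟨*⟩ adjugate M) j * d⁻¹
      ≈⟨ *-congʳ (⟨*⟩-adjugate M i j) ⟩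
    1ᴹ i j * detʳ (tabulate M) * d⁻¹
      ≈⟨ *-assoc _ _ _ ⟩
    1ᴹ i j * (detʳ (tabulate M) * d⁻¹)
      ≈⟨ *-congˡ (trans (*-congʳ (sym (det≈detʳ M))) (inverse (F (suc k)) F≉0)) ⟩
    1ᴹ i j * 1#
      ≈⟨ *-identityʳ _ ⟩
    1ᴹ i j ∎

  -- Only M E = 1 comes from the adjugate; E M = 1 follows because M is symmetric.
  Eᵀ : Matrix (suc k)
  Eᵀ i j = E j i

  Eᵀ*M≈1 : ∀ i → (Eᵀ i ⟨*⟩ M) ≋ basis i
  Eᵀ*M≈1 i j = begin
    sum (λ l → E l i * M l j) ≈⟨ sum-cong-≋ (λ l → trans (*-comm (E l i) (M l j)) (*-congʳ (M-symmetric l j))) ⟩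
    sum (λ l → M j l * E l i) ≈⟨ M*E≈1 j i ⟩
    basis j i                 ≈⟨ basis-sym j i ⟩
    basis i j                 ∎

  -- A left and a right inverse of the same matrix coincide: `Eᵀ = Eᵀ (M E) = (Eᵀ M) E = E`.
  Eᵀ≈E : Eᵀ ≈ᴹ E
  Eᵀ≈E i j = begin
    Eᵀ i j
      ≈⟨ basis-row j ⟨
    sum (λ l → Eᵀ i l * 1ᴹ l j)
      ≈⟨ sum-cong-≋ (λ l → *-congˡ {Eᵀ i l} (M*E≈1 l j)) ⟨
    (Eᵀ i ⟨*⟩ (λ l → M l ⟨*⟩ E)) j
      ≈⟨ ⟨*⟩-assoc (Eᵀ i) M E j ⟨
    ((Eᵀ i ⟨*⟩ M) ⟨*⟩ E) j
      ≈⟨ ⟨*⟩-linear E j .cong (Eᵀ*M≈1 i) ⟩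
    (basis i ⟨*⟩ E) j
      ≈⟨ basis-⟨*⟩ i E j ⟩
    E i j ∎
    where
    basis-row : ∀ j → sum (λ l → Eᵀ i l * 1ᴹ l j) ≈ Eᵀ i j
    basis-row j = sym (linear-expand (proj-linear j) (Eᵀ i))

  E*M≈1 : (E *ᴹ M) ≈ᴹ 1ᴹ
  E*M≈1 i j = trans (⟨*⟩-linear M j .cong (λ l → sym (Eᵀ≈E i l))) (Eᵀ*M≈1 i j)

  E-inverse : IsInverseOf E (1- A k)
  E-inverse = E*M≈1 , M*E≈1

  fold⁺-E : ∀ l (F⁺≉0 : F⁺ (suc k) ≉ 0#) →
            fold⁺ (E zero) l ≈ F⁺-cofactor k l * F⁺ (suc k) ⁻¹[ F⁺≉0 ]
  fold⁺-E l = cramer₀ (1- A⁺ k) (fold⁺ (E zero)) (λ j → begin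
    (fold⁺ (E zero) ⟨*⟩ (1- A⁺ k)) j ≈⟨ fold⁺-intertwines (E zero) j ⟨
    fold⁺ (E zero ⟨*⟩ M) j           ≈⟨ fold⁺-linear j .cong (E*M≈1 zero) ⟩
    -- `ι⁺ zero` reduces to `zero`, so the first row of the identity already has the shape that
    -- `fold⁺-basis` expects.
    fold⁺ (basis (ι⁺ zero)) j        ≈⟨ fold⁺-basis zero j ⟩
    basis zero j                     ∎) l

  ι⁺-index : ∀ ℓ 2ℓ≤k ℓ≤k → ι⁺ (index⁺ ℓ 2ℓ≤k) ≡ index ℓ ℓ≤k
  ι⁺-index ℓ 2ℓ≤k ℓ≤k = Fin.toℕ-injective
    (≡.trans (toℕ-ι⁺ (index⁺ ℓ 2ℓ≤k)) (≡.trans (toℕ-index⁺ ℓ 2ℓ≤k) (≡.sym (Fin.toℕ-fromℕ< _))))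

  ι⁻-index : ∀ ℓ 2ℓ<k ℓ≤k → ι⁻ (index⁻ ℓ 2ℓ<k) ≡ index ℓ ℓ≤k
  ι⁻-index ℓ 2ℓ<k ℓ≤k = Fin.toℕ-injective
    (≡.trans (toℕ-ι⁻ (index⁻ ℓ 2ℓ<k)) (≡.trans (toℕ-index⁻ ℓ 2ℓ<k) (≡.sym (Fin.toℕ-fromℕ< _))))

  ρ-index : ∀ ℓ (ℓ≤k : ℓ ≤ k) → ρ (index ℓ ℓ≤k) ≡ index (k ∸ ℓ) (m∸n≤m k ℓ)
  ρ-index ℓ ℓ≤k = Fin.toℕ-injective (≡.trans (toℕ-ρ (index ℓ ℓ≤k))
    (≡.trans (≡.cong (k ∸_) (Fin.toℕ-fromℕ< (ℕ.s≤s ℓ≤k))) (≡.sym (Fin.toℕ-fromℕ< (ℕ.s≤s (m∸n≤m k ℓ))))))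

  E-sum : ∀ ℓ (2ℓ<k : 2 *ℕ ℓ < k) (F⁺≉0 : F⁺ (suc k) ≉ 0#) →
    E zero (index ℓ (2ℓ<k⇒ℓ≤k ℓ 2ℓ<k)) + E zero (index (k ∸ ℓ) (m∸n≤m k ℓ))
      ≈ F⁺-cofactor k (index⁺ ℓ (<⇒≤ 2ℓ<k)) * F⁺ (suc k) ⁻¹[ F⁺≉0 ]
  E-sum ℓ 2ℓ<k F⁺≉0 = begin
    E zero (index ℓ ℓ≤k) + E zero (index (k ∸ ℓ) (m∸n≤m k ℓ))
      ≡⟨ ≡.cong (λ i → E zero (index ℓ ℓ≤k) + E zero i) (ρ-index ℓ ℓ≤k) ⟨
    E zero (index ℓ ℓ≤k) + E zero (ρ (index ℓ ℓ≤k))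
      ≡⟨ ≡.cong (λ i → E zero i + E zero (ρ i)) (ι⁺-index ℓ (<⇒≤ 2ℓ<k) ℓ≤k) ⟨
    E zero (ι⁺ l) + E zero (ρ (ι⁺ l))
      ≈⟨ fold⁺-below (E zero) l (≡.subst (λ n → 2 *ℕ n < k) (≡.sym (toℕ-index⁺ ℓ (<⇒≤ 2ℓ<k))) 2ℓ<k) ⟨
    fold⁺ (E zero) l
      ≈⟨ fold⁺-E l F⁺≉0 ⟩
    F⁺-cofactor k l * F⁺ (suc k) ⁻¹[ F⁺≉0 ] ∎
    where
    l = index⁺ ℓ (<⇒≤ 2ℓ<k)
    ℓ≤k = 2ℓ<k⇒ℓ≤k ℓ 2ℓ<k

  -- The central coordinate of `fold⁺` is a single entry, so the Cramer formula that yields sums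
  -- elsewhere gives `E` itself here.
  E-middle : ∀ h (2h≡k : 2 *ℕ h ≡ k) (F⁺≉0 : F⁺ (suc k) ≉ 0#) →
    E zero (index h (2ℓ≡k⇒ℓ≤k h 2h≡k))
      ≈ F⁺-cofactor k (index⁺ h (≤-reflexive 2h≡k)) * F⁺ (suc k) ⁻¹[ F⁺≉0 ]
  E-middle h 2h≡k F⁺≉0 = begin
    E zero (index h (2ℓ≡k⇒ℓ≤k h 2h≡k))
      ≡⟨ ≡.cong (E zero) (ι⁺-index h (≤-reflexive 2h≡k) (2ℓ≡k⇒ℓ≤k h 2h≡k)) ⟨
    E zero (ι⁺ l)
      ≈⟨ fold⁺-middle (E zero) l (λ 2l<k → ℕ.<-irrefl 2h≡k
           (≡.subst (λ n → 2 *ℕ n < k) (toℕ-index⁺ h (≤-reflexive 2h≡k)) 2l<k)) ⟨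
    fold⁺ (E zero) l
      ≈⟨ fold⁺-E l F⁺≉0 ⟩
    F⁺-cofactor k l * F⁺ (suc k) ⁻¹[ F⁺≉0 ] ∎
    where
    l = index⁺ h (≤-reflexive 2h≡k)

  fold⁻-E : ∀ l (F⁻≉0 : F⁻ (suc k) ≉ 0#) →
            fold⁻ (E zero) l ≈ F⁻-cofactor k l * F⁻ (suc k) ⁻¹[ F⁻≉0 ]
  fold⁻-E l = cramer₀ (1- A⁻ k) (fold⁻ (E zero)) (λ j → begin
    (fold⁻ (E zero) ⟨*⟩ (1- A⁻ k)) j ≈⟨ fold⁻-intertwines (E zero) j ⟨
    fold⁻ (E zero ⟨*⟩ M) j           ≈⟨ fold⁻-linear j .cong (E*M≈1 zero) ⟩
    fold⁻ (basis (ι⁻ zero)) j        ≈⟨ fold⁻-basis zero j ⟩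
    basis zero j                     ∎) l

  E-difference : ∀ ℓ (2ℓ<k : 2 *ℕ ℓ < k) (F⁻≉0 : F⁻ (suc k) ≉ 0#) →
    E zero (index ℓ (2ℓ<k⇒ℓ≤k ℓ 2ℓ<k)) - E zero (index (k ∸ ℓ) (m∸n≤m k ℓ))
      ≈ F⁻-cofactor k (index⁻ ℓ 2ℓ<k) * F⁻ (suc k) ⁻¹[ F⁻≉0 ]
  E-difference ℓ 2ℓ<k F⁻≉0 = begin
    E zero (index ℓ ℓ≤k) - E zero (index (k ∸ ℓ) (m∸n≤m k ℓ))
      ≡⟨ ≡.cong (λ i → E zero (index ℓ ℓ≤k) - E zero i) (ρ-index ℓ ℓ≤k) ⟨
    E zero (index ℓ ℓ≤k) - E zero (ρ (index ℓ ℓ≤k))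
      ≡⟨ ≡.cong (λ i → E zero i - E zero (ρ i)) (ι⁻-index ℓ 2ℓ<k ℓ≤k) ⟨
    fold⁻ (E zero) (index⁻ ℓ 2ℓ<k)
      ≈⟨ fold⁻-E (index⁻ ℓ 2ℓ<k) F⁻≉0 ⟩
    F⁻-cofactor k (index⁻ ℓ 2ℓ<k) * F⁻ (suc k) ⁻¹[ F⁻≉0 ] ∎
    where
    ℓ≤k = 2ℓ<k⇒ℓ≤k ℓ 2ℓ<k

mainTheorem11 : ∀ {c e} (K : Field c e) → CharacteristicZero K →
    (W : WeightedSet K) → Symmetric K W →
    let open Field K
        open Matrices K
        open Transfer K W
    in
    (∀ k → F k ≈ F⁺ k * F⁻ k)
    ×
    (∀ k → 1 ≤ k → F (suc k) ≉ 0# →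
      Σ[ F⁺≉0 ∈ F⁺ (suc k) ≉ 0# ]
      Σ[ F⁻≉0 ∈ F⁻ (suc k) ≉ 0# ]
      Σ[ E ∈ Matrix (suc k) ]
        IsInverseOf E (1- A k)
        ×
        (∀ ℓ (2ℓ<k : 2 *ℕ ℓ < k) →
          (E zero (index ℓ (2ℓ<k⇒ℓ≤k ℓ 2ℓ<k)) + E zero (index (k ∸ ℓ) (m∸n≤m k ℓ))
            ≈ F⁺-cofactor k (index⁺ ℓ (<⇒≤ 2ℓ<k)) * F⁺ (suc k) ⁻¹[ F⁺≉0 ])
          ×
          (E zero (index ℓ (2ℓ<k⇒ℓ≤k ℓ 2ℓ<k)) - E zero (index (k ∸ ℓ) (m∸n≤m k ℓ))
            ≈ F⁻-cofactor k (index⁻ ℓ 2ℓ<k) * F⁻ (suc k) ⁻¹[ F⁻≉0 ]))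
        ×
        (∀ h (2h≡k : 2 *ℕ h ≡ k) →
          E zero (index h (2ℓ≡k⇒ℓ≤k h 2h≡k))
            ≈ F⁺-cofactor k (index⁺ h (≤-reflexive 2h≡k)) * F⁺ (suc k) ⁻¹[ F⁺≉0 ]))
mainTheorem11 K char0 W W-sym = factorization , (λ where
  (suc k′) _ F≉0 →
    let open Inverse K W ω-even k′ F≉0 in
    F⁺≉0 (suc (suc k′)) F≉0 , F⁻≉0 (suc (suc k′)) F≉0 , E , E-inverse ,
    (λ ℓ 2ℓ<k → E-sum ℓ 2ℓ<k (F⁺≉0 (suc (suc k′)) F≉0) , E-difference ℓ 2ℓ<k (F⁻≉0 (suc (suc k′)) F≉0)) ,
    (λ h 2h≡k → E-middle h 2h≡k (F⁺≉0 (suc (suc k′)) F≉0)))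
  where
  open Field K
  open Transfer K W

  ω-even : ∀ s → WeightedSet.ω W (ℤ.- s) ≈ WeightedSet.ω W s
  ω-even = symmetric⇒even K W W-sym

  2≉0 : 1# + 1# ≉ 0#
  -- The multiple `2 · 1#` unfolds to `1# + (1# + 0#)`.
  2≉0 2≈0 = char0 1 (trans (+-congˡ (+-identityʳ 1#)) 2≈0)

  factorization : ∀ k → F k ≈ F⁺ k * F⁻ k
  factorization zero    = sym (*-identityˡ 1#)
  factorization (suc k) = Factorization.F-factorizes K ((1# + 1#) ⁻¹[ 2≉0 ])
    (trans (*-comm _ _) (inverse (1# + 1#) 2≉0)) W ω-even k

  F⁺≉0 : ∀ k → F k ≉ 0# → F⁺ k ≉ 0#
  F⁺≉0 k F≉0 F⁺≈0 = F≉0 (trans (factorization k) (trans (*-congʳ F⁺≈0) (zeroˡ _)))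

  F⁻≉0 : ∀ k → F k ≉ 0# → F⁻ k ≉ 0#
  F⁻≉0 k F≉0 F⁻≈0 = F≉0 (trans (factorization k) (trans (*-congˡ F⁻≈0) (zeroʳ _)))
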